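{- Let $v\ne 7$ with $v\equiv 1\pmod 6$ or $v\equiv 9\pmod{18}$. Then every cyclic $\mathrm{STS}(v)$ admits a zero-sum $3$-flow.
   Context: A Steiner triple system $\mathrm{STS}(v)$ is a pair $(X,\mathcal{B})$ with $|X|=v$ and $\mathcal{B}$ a collection of 3-subsets of $X$ such that every 2-subset lies in exactly one block. It is cyclic if, after relabeling, $X=\mathbb{Z}_v$ and $i\mapsto i+1\pmod v$ maps blocks to blocks. For a design $(X,\mathcal{B})$ and integer $n\ge2$, a zero-sum $n$-flow is a map $f:\mathcal{B}\to\{\pm1,\ldots,\pm(n-1)\}$ such that $\sum_{B\ni x} f(B)=0$ for every point $x$; thus a zero-sum 3-flow takes values in $\{\pm1,\pm2\}$. -}

module Defs where

open import Data.Bool.Base using (if_then_else_)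
open import Data.Fin.Base using (Fin; toℕ)
open import Data.Fin.Permutation using (Permutation′; _⟨$⟩ʳ_)
open import Data.Fin.Properties using (any?; nonZeroIndex; _≟_)
open import Data.Fin.Subset using (Subset; _∈_; _⊆_; ∣_∣)
open import Data.Fin.Subset.Properties using (_∈?_)
open import Data.Integer.Base as ℤ using (ℤ; 0ℤ)
open import Data.Integer.Properties using (+-0-commutativeMonoid)
open import Data.Nat.Base using (ℕ; suc; _≤_; _<_)
open import Data.Nat.DivMod using (_mod_)
open import Data.Product.Base using (_×_; ∃-syntax; Σ-syntax)
open import Data.Product using (∃!)
open import Data.Vec.Base using (tabulate)
open import Function.Definitions using (Injective)
open import Relation.Binary.PropositionalEquality using (_≡_)
open import Relation.Nullary.Decidable using (does; _×-dec_)

open import Algebra.Properties.CommutativeMonoid.Sum +-0-commutativeMonoid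
  using (sum)

-- The points are Fin v.  The set of blocks is enumerated without repetition,
-- so functions on the set of blocks are functions on Fin #blocks.
record Design (v : ℕ) : Set where
  field
    #blocks         : ℕ
    block           : Fin #blocks → Subset v
    block-injective : Injective _≡_ _≡_ block

record IsSteinerTripleSystem {v : ℕ} (D : Design v) : Set where
  open Design D
  field
    block-size   : ∀ j → ∣ block j ∣ ≡ 3
    pair-covered : ∀ (P : Subset v) → ∣ P ∣ ≡ 2 → ∃! _≡_ (λ j → P ⊆ block j)

image : ∀ {m n} → (Fin m → Fin n) → Subset m → Subset n
image f B = tabulate λ y → does (any? λ x → (x ∈? B) ×-dec (f x ≟ y))

-- i ↦ i + 1 (mod v) on ℤ_v, with Fin v holding the least residues.
shift : ∀ {v} → Fin v → Fin v
shift {v} i = (suc (toℕ i) mod v) {{nonZeroIndex i}}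

-- The permutation π is the relabelling of the points by ℤ_v; the blocks of the
-- relabelled design are the sets image (π ⟨$⟩ʳ_) (block j).
IsCyclic : ∀ {v} → Design v → Set
IsCyclic {v} D = Σ[ π ∈ Permutation′ v ]
    (∀ j → ∃[ k ] image shift (image (π ⟨$⟩ʳ_) (block j))
                  ≡ image (π ⟨$⟩ʳ_) (block k))
  where open Design D

-- The condition on ∣ f j ∣ says f j ∈ {±1, …, ±(n − 1)}.
record ZeroSumFlow (n : ℕ) {v : ℕ} (D : Design v) : Set where
  open Design D
  field
    f        : Fin #blocks → ℤ
    range    : ∀ j → 1 ≤ ℤ.∣ f j ∣ × ℤ.∣ f j ∣ < n
    zero-sum : ∀ (x : Fin v) →
               sum (λ j → if does (x ∈? block j) then f j else 0ℤ) ≡ 0ℤ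

-- Rotation permutes the blocks.  If f is constant on its orbits, the sum of f
-- over the blocks through a point x does not depend on x, and v times it is
-- 3 Σ f; so only the total of f matters.
--
-- If v ≡ 1 (mod 6), every orbit has v blocks, and since v ≠ 7 there are at least
-- two orbits: give one the value 1 and the others ±1, ±2 with total -1.
--
-- If v ≡ 9 (mod 18), write v = 3w.  A block fixed by a nontrivial rotation is a
-- coset of wℤ_v, so orbits have v or w blocks.  Counting pairs of points by their
-- residues modulo 3 gives a block with three distinct residues; its orbit has v
-- blocks and splits into three parallel classes.  These may get separate
-- values z, -1, -1, contributing z - 2 at each point.  The orbits of size w get
-- values of total 1, the remaining ones of total s, contributing 1 + 3s, with
-- (z, s) = (-2, 1), or (1, 0) if there are no remaining ones.

{-# OPTIONS --safe #-}
module Submission where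

open import Defs
open import Data.Bool.Base using (Bool; true; false; if_then_else_; _∧_; not)
import Data.Bool.Properties as Bool
open import Data.Fin.Base as Fin using (Fin; zero; suc; toℕ; fromℕ<)
open import Data.Fin.Permutation
  using (Permutation′; permutation; _⟨$⟩ʳ_; _⟨$⟩ˡ_; inverseˡ; inverseʳ)
import Data.Fin.Properties as Fin
open import Data.Fin.Subset using (Subset; _∈_; _⊆_; ∣_∣; inside; outside; ⁅_⁆; _∪_)
open import Data.Fin.Subset.Properties
  using (_∈?_; ∪-identityˡ; ∪-identityʳ; ∣⁅x⁆∣≡1; x∈⁅x⁆; x∈⁅y⁆⇒x≡y; x∈p∪q⁻; x∈p∪q⁺)
open import Data.Integer.Base as ℤ using (ℤ; +_; -[1+_]; 0ℤ; 1ℤ; -1ℤ; _+_; _*_; _-_)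
import Data.Integer.Properties as ℤ
open import Data.Integer.Tactic.RingSolver using (solve-∀)
open import Data.Nat.Base as ℕ
  using (ℕ; zero; suc; _<_; _≤_; z≤n; s≤s; NonZero; _%_; _/_)
open import Data.Nat.Divisibility as ∣ using (_∣_; divides)
open import Data.Nat.DivMod
open import Data.Nat.GeneralisedArithmetic using (fold; fold-+)
import Data.Nat.Properties as ℕ
import Data.Nat.Tactic.RingSolver as ℕSolver
open import Data.Product.Base using (∃; ∃-syntax; Σ-syntax; _×_; _,_; proj₁; proj₂)
open import Data.Sum.Base using (_⊎_; inj₁; inj₂)
open import Data.Vec.Base using ([]; _∷_; here; there)
open import Data.Vec.Functional using () renaming ([] to []ᶠ; _∷_ to _∷ᶠ_)
open import Data.Vec.Properties using ([]=⇒lookup; lookup⇒[]=; lookup∘tabulate)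
open import Function.Base using (_∘_)
open import Function.Bundles using (_⇔_; mk⇔)
open import Function.Definitions using (Injective)
open import Relation.Binary.PropositionalEquality
open import Relation.Nullary.Decidable
open import Relation.Nullary.Negation using (¬_; contradiction)
open import Relation.Unary using (Decidable)

open import Algebra.Properties.CommutativeMonoid.Sum ℤ.+-0-commutativeMonoid
  using (sum; sum-cong-≗; sum-remove; ∑-distrib-+; ∑-comm; sum-permute; sum-replicate-zero)
open import Algebra.Properties.Semiring.Sum ℤ.+-*-semiring using (*-distribˡ-sum)

open ≡-Reasoning


-- Finite sums of integers

infixr 7 _⊙_
_⊙_ : Bool → ℤ → ℤ
b ⊙ z = if b then z else 0ℤ

⊙-zeroʳ : ∀ b → b ⊙ 0ℤ ≡ 0ℤ
⊙-zeroʳ true  = refl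
⊙-zeroʳ false = refl

⊙-distribˡ-+ : ∀ b y z → b ⊙ (y + z) ≡ b ⊙ y + b ⊙ z
⊙-distribˡ-+ true  y z = refl
⊙-distribˡ-+ false y z = refl

⊙-comm : ∀ b c z → b ⊙ c ⊙ z ≡ c ⊙ b ⊙ z
⊙-comm true  c z = refl
⊙-comm false c z = sym (⊙-zeroʳ c)

⊙-yes : ∀ {P : Set} (P? : Dec P) z → P → does P? ⊙ z ≡ z
⊙-yes P? z p = cong (_⊙ z) (dec-true P? p)

⊙-no : ∀ {P : Set} (P? : Dec P) z → ¬ P → does P? ⊙ z ≡ 0ℤ
⊙-no P? z ¬p = cong (_⊙ z) (dec-false P? ¬p)

⊙-dec : ∀ {P : Set} (P? : Dec P) y z → (P → y ≡ z) → (¬ P → y ≡ 0ℤ) → y ≡ does P? ⊙ z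
⊙-dec (yes p) y z f g = f p
⊙-dec (no ¬p) y z f g = g ¬p

-- Opaque, so that the unifier can compare two sums summand by summand.
opaque
  ∑ : ∀ {n} → (Fin n → ℤ) → ℤ
  ∑ = sum

opaque
  unfolding ∑

  ∑≡sum : ∀ {n} (f : Fin n → ℤ) → ∑ f ≡ sum f
  ∑≡sum f = refl

  ∑-suc : ∀ {n} (f : Fin (suc n) → ℤ) → ∑ f ≡ f zero + ∑ (f ∘ suc)
  ∑-suc f = refl

  ∑-cong : ∀ {n} {f g : Fin n → ℤ} → (∀ i → f i ≡ g i) → ∑ f ≡ ∑ g
  ∑-cong = sum-cong-≗

  ∑-+ : ∀ {n} (f g : Fin n → ℤ) → ∑ (λ i → f i + g i) ≡ ∑ f + ∑ g
  ∑-+ = ∑-distrib-+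

  ∑-swap : ∀ {m n} (f : Fin m → Fin n → ℤ) → ∑ (λ i → ∑ (f i)) ≡ ∑ (λ j → ∑ (λ i → f i j))
  ∑-swap = ∑-comm

  ∑-reindex : ∀ {n} (f : Fin n → ℤ) (π : Permutation′ n) → ∑ f ≡ ∑ (f ∘ (π ⟨$⟩ʳ_))
  ∑-reindex = sum-permute

  ∑-*ˡ : ∀ {n} z (f : Fin n → ℤ) → ∑ (λ i → z * f i) ≡ z * ∑ f
  ∑-*ˡ z f = sym (*-distribˡ-sum z f)

  ∑-zero : ∀ {n} (f : Fin n → ℤ) → (∀ i → f i ≡ 0ℤ) → ∑ f ≡ 0ℤ
  ∑-zero {n} f f≡0 = trans (sum-cong-≗ f≡0) (sum-replicate-zero n)

  ∑-single : ∀ {n} (f : Fin n → ℤ) k → (∀ i → i ≢ k → f i ≡ 0ℤ) → ∑ f ≡ f k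
  ∑-single {suc n} f k f≡0 = begin
    sum f                           ≡⟨ sum-remove {i = k} f ⟩
    f k + sum (f ∘ Fin.punchIn k)   ≡⟨ cong (_+_ (f k)) (∑-zero _ λ i → f≡0 _ (Fin.punchInᵢ≢i k i)) ⟩
    f k + 0ℤ                        ≡⟨ ℤ.+-identityʳ (f k) ⟩
    f k                             ∎

  ∑-⊙ : ∀ {n} b (f : Fin n → ℤ) → ∑ (λ i → b ⊙ f i) ≡ b ⊙ ∑ f
  ∑-⊙ true  f = refl
  ∑-⊙ {n} false f = sum-replicate-zero n

  ∑-const : ∀ n z → ∑ {n} (λ _ → z) ≡ + n * z
  ∑-const zero    z = sym (ℤ.*-zeroˡ z)
  ∑-const (suc n) z = trans (cong (_+_ z) (∑-const n z)) (sym (ℤ.suc-* (+ n) z))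

  ∑-≤0 : ∀ {n} (f : Fin n → ℤ) → (∀ i → f i ℤ.≤ 0ℤ) → ∑ f ℤ.≤ 0ℤ
  ∑-≤0 {zero}  f f≤0 = ℤ.≤-refl
  ∑-≤0 {suc n} f f≤0 = ℤ.+-mono-≤ (f≤0 zero) (∑-≤0 (f ∘ suc) (f≤0 ∘ suc))

∑-δ : ∀ {n} (k : Fin n) (h : Fin n → ℤ) → ∑ (λ i → does (k Fin.≟ i) ⊙ h i) ≡ h k
∑-δ k h = trans
  (∑-single _ k λ i i≢k → ⊙-no (k Fin.≟ i) (h i) (i≢k ∘ sym))
  (⊙-yes (k Fin.≟ k) (h k) refl)

-- Prescribed sums with summands ±1, ±2

Small : ℤ → Set
Small z = 1 ≤ ℤ.∣ z ∣ × ℤ.∣ z ∣ < 3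

small? : ∀ z → Dec (Small z)
small? z = (1 ℕ.≤? ℤ.∣ z ∣) ×-dec (ℤ.∣ z ∣ ℕ.<? 3)

-- The set of values ±1, ±2 is closed under this splitting, which lets `small-sum` peel off one
-- summand and keep an admissible target.
small-split : ∀ s → Small s → ∃[ c ] Small c × Small (s - c)
small-split (+ 1)    _ = -1ℤ , from-yes (small? -1ℤ) , from-yes (small? (+ 2))
small-split (+ 2)    _ = 1ℤ , from-yes (small? 1ℤ) , from-yes (small? 1ℤ)
small-split -[1+ 0 ] _ = 1ℤ , from-yes (small? 1ℤ) , from-yes (small? -[1+ 1 ])
small-split -[1+ 1 ] _ = -1ℤ , from-yes (small? -1ℤ) , from-yes (small? -1ℤ)
small-split (+ suc (suc (suc _))) (_ , s≤s (s≤s (s≤s ())))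
small-split -[1+ suc (suc _) ]    (_ , s≤s (s≤s (s≤s ())))

small-1 : Small 1ℤ
small-1 = from-yes (small? 1ℤ)

-- Induction on the index range: an index of `R` with a later companion takes one half of a
-- `small-split`, and the last index of `R` takes the whole remaining target. Indices outside `R`
-- get the default 1, because `g` has to be small everywhere.
small-sum : ∀ {n} {R : Fin n → Set} (R? : Decidable R) s → ∃ R → Small s →
            Σ[ g ∈ (Fin n → ℤ) ] (∀ i → Small (g i)) × ∑ (λ i → does (R? i) ⊙ g i) ≡ s
small-sum {suc n} R? s (k , Rk) s-small with R? zero | Fin.any? (R? ∘ suc)
... | yes R₀ | yes ∃R =
  let c , c-small , s-c-small = small-split s s-small
      g , g-small , ∑g        = small-sum (R? ∘ suc) (s - c) ∃R s-c-small
  in (c ∷ᶠ g) , (λ { zero → c-small ; (suc i) → g-small i })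
     , trans (∑-suc _) (trans (cong₂ _+_ (⊙-yes (R? zero) c R₀) ∑g) (cancel c s))
  where
  cancel : ∀ c s → c + (s - c) ≡ s
  cancel = solve-∀
... | yes R₀ | no ∄R = (s ∷ᶠ λ _ → 1ℤ) , (λ { zero → s-small ; (suc i) → small-1 })
     , trans (∑-suc _) (trans (cong₂ _+_ (⊙-yes (R? zero) s R₀) rest≡0) (ℤ.+-identityʳ s))
  where
  rest≡0 : ∑ (λ i → does (R? (suc i)) ⊙ 1ℤ) ≡ 0ℤ
  rest≡0 = ∑-zero _ λ i → ⊙-no (R? (suc i)) 1ℤ λ r → ∄R (i , r)
small-sum {suc n} R? s (zero  , Rk) s-small | no ¬R₀ | _ = contradiction Rk ¬R₀
small-sum {suc n} R? s (suc k , Rk) s-small | no ¬R₀ | _ =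
  let g , g-small , ∑g = small-sum (R? ∘ suc) s (k , Rk) s-small
  in (1ℤ ∷ᶠ g) , (λ { zero → small-1 ; (suc i) → g-small i })
     , trans (∑-suc _) (trans (cong₂ _+_ (⊙-no (R? zero) 1ℤ ¬R₀) ∑g) (ℤ.+-identityˡ s))

-- Orbits of an injective map

-- Minimality is phrased by divisibility rather than by order: the study of stabilizers ends in
-- divisibility statements, and distinctness of the first p iterates follows from them.
record Period {A : Set} (f : A → A) (p : ℕ) (x : A) : Set where
  field
    returns : fold x f p ≡ x
    minimal : ∀ i → fold x f i ≡ x → p ∣ i

fold-comm : ∀ {A : Set} (f : A → A) (x : A) i j → fold (fold x f i) f j ≡ fold (fold x f j) f i
fold-comm f x i j = begin
  fold (fold x f i) f j  ≡⟨ fold-+ x f j ⟨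
  fold x f (j ℕ.+ i)     ≡⟨ cong (fold x f) (ℕ.+-comm j i) ⟩
  fold x f (i ℕ.+ j)     ≡⟨ fold-+ x f i ⟩
  fold (fold x f j) f i  ∎

fold-∣ : ∀ {A : Set} (f : A → A) (x : A) {p i} → fold x f p ≡ x → p ∣ i → fold x f i ≡ x
fold-∣ f x {p} eq (divides zero    refl) = refl
fold-∣ f x {p} eq (divides (suc q) refl) = begin
  fold x f (p ℕ.+ q ℕ.* p)       ≡⟨ fold-+ x f p ⟩
  fold (fold x f (q ℕ.* p)) f p  ≡⟨ cong (λ y → fold y f p) (fold-∣ f x eq (divides q refl)) ⟩
  fold x f p                     ≡⟨ eq ⟩
  x                              ∎

fold-% : ∀ {A : Set} (f : A → A) (x : A) {p} .{{_ : NonZero p}} i → fold x f p ≡ x →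
         fold x f i ≡ fold x f (i % p)
fold-% f x {p} i eq = begin
  fold x f i                               ≡⟨ cong (fold x f) (m≡m%n+[m/n]*n i p) ⟩
  fold x f (i % p ℕ.+ (i / p) ℕ.* p)       ≡⟨ fold-+ x f (i % p) ⟩
  fold (fold x f ((i / p) ℕ.* p)) f (i % p)
    ≡⟨ cong (λ y → fold y f (i % p)) (fold-∣ f x eq (divides (i / p) refl)) ⟩
  fold x f (i % p)                         ∎

module Orbits {A : Set} (f : A → A) (f-injective : Injective _≡_ _≡_ f) where

  fold-injective : ∀ i {x y} → fold x f i ≡ fold y f i → x ≡ y
  fold-injective zero    eq = eq
  fold-injective (suc i) eq = fold-injective i (f-injective eq)

  fold-cancel : ∀ x i d → fold x f (i ℕ.+ d) ≡ fold x f i → fold x f d ≡ x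
  fold-cancel x i d eq = fold-injective i (trans (sym (fold-+ x f i)) eq)

  period-∣-∸ : ∀ {p x} → Period f p x → ∀ {i j} → i ≤ j → fold x f i ≡ fold x f j → p ∣ j ℕ.∸ i
  period-∣-∸ {x = x} per {i} {j} i≤j eq = Period.minimal per (j ℕ.∸ i)
    (fold-cancel x i (j ℕ.∸ i) (trans (cong (fold x f) (ℕ.m+[n∸m]≡n i≤j)) (sym eq)))

  private
    fold-unique-≤ : ∀ {p x} → Period f p x → ∀ {i j} → i ≤ j → j < p → fold x f i ≡ fold x f j → i ≡ j
    fold-unique-≤ per {i} {j} i≤j j<p eq with j ℕ.∸ i in d | period-∣-∸ per i≤j eq
    ... | zero  | _ = ℕ.≤-antisym i≤j (ℕ.m∸n≡0⇒m≤n d)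
    ... | suc k | p∣ = contradiction (∣.∣⇒≤ p∣)
      (ℕ.<⇒≱ (ℕ.≤-<-trans (ℕ.≤-trans (ℕ.≤-reflexive (sym d)) (ℕ.m∸n≤m j i)) j<p))

  fold-unique : ∀ {p x} → Period f p x → ∀ {i j} → i < p → j < p → fold x f i ≡ fold x f j → i ≡ j
  fold-unique per {i} {j} i<p j<p eq with ℕ.≤-total i j
  ... | inj₁ i≤j = fold-unique-≤ per i≤j j<p eq
  ... | inj₂ j≤i = sym (fold-unique-≤ per j≤i i<p (sym eq))

  module _ (_≟_ : (x y : A) → Dec (x ≡ y)) where

    -- The iterates `fold x f i` with i < p are pairwise distinct, so a single summand survives.
    -- This evaluates at `y` a function given by exponents along the orbit of `x`.
    ∑-orbit : ∀ {p x} → Period f p x → ∀ (h : ℕ → ℤ) y {k} → k < p → fold x f k ≡ y →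
                ∑ {p} (λ i → does (fold x f (toℕ i) ≟ y) ⊙ h (toℕ i)) ≡ h k
    ∑-orbit {p} {x} per h y {k} k<p eq = begin
      ∑ (λ i → does (fold x f (toℕ i) ≟ y) ⊙ h (toℕ i))
        ≡⟨ ∑-single _ k′ (λ i i≢k → ⊙-no (_ ≟ y) _ λ eq′ →
             i≢k (Fin.toℕ-injective (fold-unique per (Fin.toℕ<n i) (Fin.toℕ<n k′)
               (trans eq′ (sym eq″))))) ⟩
      does (fold x f (toℕ k′) ≟ y) ⊙ h (toℕ k′)  ≡⟨ ⊙-yes (_ ≟ y) _ eq″ ⟩
      h (toℕ k′)                                 ≡⟨ cong h (Fin.toℕ-fromℕ< k<p) ⟩
      h k                                        ∎
      where
      k′  = fromℕ< k<p
      eq″ = trans (cong (fold x f) (Fin.toℕ-fromℕ< k<p)) eq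

    ∑-outside-orbit : ∀ {p x} (h : ℕ → ℤ) y → (∀ i → fold x f i ≢ y) →
                        ∑ {p} (λ i → does (fold x f (toℕ i) ≟ y) ⊙ h (toℕ i)) ≡ 0ℤ
    ∑-outside-orbit h y ≢y = ∑-zero _ λ i → ⊙-no (_ ≟ y) _ (≢y (toℕ i))

least : ∀ {n} {P : Fin n → Set} → Decidable P → ∃ P → ∃[ k ] P k × (∀ l → P l → k Fin.≤ l)
least {suc n} P? (k , Pk) with P? zero
least {suc n} P? (k , Pk)     | yes P₀ = zero , P₀ , λ _ _ → z≤n
least {suc n} P? (zero , Pk)  | no ¬P₀ = contradiction Pk ¬P₀
least {suc n} P? (suc k , Pk) | no ¬P₀ =
  let m , Pm , m≤ = least (P? ∘ suc) (k , Pk)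
  in suc m , Pm , λ { zero P₀ → contradiction P₀ ¬P₀ ; (suc l) Pl → s≤s (m≤ l Pl) }

-- Orbit representatives for a map of finite order

module Representatives {b : ℕ} (f : Fin b → Fin b) (f-injective : Injective _≡_ _≡_ f)
                       (v : ℕ) .{{_ : NonZero v}} (f^v : ∀ x → fold x f v ≡ x) where

  open Orbits f f-injective

  infix 4 _∼_ _∼?_
  _∼_ : Fin b → Fin b → Set
  x ∼ y = ∃[ i ] fold x f i ≡ y

  reduce : ∀ {x y} → x ∼ y → ∃[ i ] i < v × fold x f i ≡ y
  reduce {x} (i , eq) = i % v , m%n<n i v , trans (sym (fold-% f x i (f^v x))) eq

  _∼?_ : ∀ x y → Dec (x ∼ y)
  x ∼? y = map′ (λ (i , eq) → toℕ i , eq)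
    (λ r → let i , i<v , eq = reduce r in fromℕ< i<v , trans (cong (fold x f) (Fin.toℕ-fromℕ< i<v)) eq)
    (Fin.any? λ (i : Fin v) → fold x f (toℕ i) Fin.≟ y)

  ∼-trans : ∀ {x y z} → x ∼ y → y ∼ z → x ∼ z
  ∼-trans {x} (i , refl) (j , refl) = j ℕ.+ i , fold-+ x f j

  ∼-sym : ∀ {x y} → x ∼ y → y ∼ x
  ∼-sym {x} {y} r with i , i<v , eq ← reduce r = v ℕ.∸ i , (begin
    fold y f (v ℕ.∸ i)              ≡⟨ cong (λ y → fold y f (v ℕ.∸ i)) (sym eq) ⟩
    fold (fold x f i) f (v ℕ.∸ i)   ≡⟨ fold-+ x f (v ℕ.∸ i) ⟨
    fold x f (v ℕ.∸ i ℕ.+ i)        ≡⟨ cong (fold x f) (ℕ.m∸n+n≡m (ℕ.<⇒≤ i<v)) ⟩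
    fold x f v                      ≡⟨ f^v x ⟩
    x                               ∎)

  private
    least-∼ : ∀ x → ∃[ k ] x ∼ k × (∀ l → x ∼ l → k Fin.≤ l)
    least-∼ x = least (x ∼?_) (x , 0 , refl)

  -- Taking the least element makes the representative canonical: lying in one orbit becomes a
  -- decidable equality, and the orbits are indexed by the fixed points of `rep`.
  rep : Fin b → Fin b
  rep x = proj₁ (least-∼ x)

  ∼-rep : ∀ x → x ∼ rep x
  ∼-rep x = proj₁ (proj₂ (least-∼ x))

  rep-cong : ∀ {x y} → x ∼ y → rep x ≡ rep y
  rep-cong {x} {y} r = Fin.≤-antisym
    (proj₂ (proj₂ (least-∼ x)) (rep y) (∼-trans r (∼-rep y)))
    (proj₂ (proj₂ (least-∼ y)) (rep x) (∼-trans (∼-sym r) (∼-rep x)))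

  rep-injective : ∀ {x y} → rep x ≡ rep y → x ∼ y
  rep-injective {x} {y} eq = ∼-trans (subst (x ∼_) eq (∼-rep x)) (∼-sym (∼-rep y))

  rep-rep : ∀ x → rep (rep x) ≡ rep x
  rep-rep x = sym (rep-cong (∼-rep x))

  module _ (size : Fin b → ℕ) (size≢0 : ∀ x → NonZero (size x)) (period : ∀ x → Period f (size x) x) where

    -- Double counting of the pairs (i, x) with i < `size r` and `fold r f i` equal to x: each x in
    -- the orbit is visited once, each i visits one x.
    orbit-size : ∀ r → ∑ (λ x → does (rep r Fin.≟ rep x) ⊙ 1ℤ) ≡ + size r
    orbit-size r = begin
      ∑ (λ x → does (rep r Fin.≟ rep x) ⊙ 1ℤ)
        ≡⟨ ∑-cong (λ x → ⊙-dec (rep r Fin.≟ rep x) (visits x) 1ℤ (in-orbit x) (off-orbit x)) ⟨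
      ∑ visits
        ≡⟨ ∑-swap (λ x i → does (fold r f (toℕ i) Fin.≟ x) ⊙ 1ℤ) ⟩
      ∑ {size r} (λ i → ∑ (λ x → does (fold r f (toℕ i) Fin.≟ x) ⊙ 1ℤ))
        ≡⟨ ∑-cong (λ i → ∑-δ (fold r f (toℕ {size r} i)) (λ _ → 1ℤ)) ⟩
      ∑ {size r} (λ i → 1ℤ)  ≡⟨ ∑-const (size r) 1ℤ ⟩
      + size r * 1ℤ            ≡⟨ ℤ.*-identityʳ (+ size r) ⟩
      + size r                 ∎
      where
      instance _ = size≢0 r
      visits : Fin b → ℤ
      visits x = ∑ {size r} (λ i → does (fold r f (toℕ i) Fin.≟ x) ⊙ 1ℤ)
      in-orbit : ∀ x → rep r ≡ rep x → visits x ≡ 1ℤ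
      in-orbit x eq with i , fi ← rep-injective {r} {x} eq =
        ∑-orbit Fin._≟_ (period r) (λ _ → 1ℤ) x (m%n<n i (size r))
          (trans (sym (fold-% f r {size r} i (Period.returns (period r)))) fi)
      off-orbit : ∀ x → rep r ≢ rep x → visits x ≡ 0ℤ
      off-orbit x ≢ = ∑-outside-orbit Fin._≟_ {size r} {r} (λ _ → 1ℤ) x λ i fi → ≢ (rep-cong (i , fi))

    -- Each `G (rep x)` is spread out as a sum of delta terms over r. After the swap, the column of
    -- r vanishes unless r represents its own orbit, and then it counts that orbit.
    ∑-over-orbits : (G : Fin b → ℤ) →
      ∑ (λ x → G (rep x)) ≡ ∑ (λ r → does (rep r Fin.≟ r) ⊙ (+ size r * G r))
    ∑-over-orbits G = begin
      ∑ (λ x → G (rep x))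
        ≡⟨ ∑-cong (λ x → sym (∑-δ (rep x) G)) ⟩
      ∑ (λ x → ∑ (λ r → does (rep x Fin.≟ r) ⊙ G r))
        ≡⟨ ∑-swap (λ x r → does (rep x Fin.≟ r) ⊙ G r) ⟩
      ∑ (λ r → ∑ (λ x → does (rep x Fin.≟ r) ⊙ G r))
        ≡⟨ ∑-cong (λ r → ⊙-dec (rep r Fin.≟ r) (col r) (+ size r * G r) (is-rep r) (not-rep r)) ⟩
      ∑ (λ r → does (rep r Fin.≟ r) ⊙ (+ size r * G r)) ∎
      where
      col : Fin b → ℤ
      col r = ∑ (λ x → does (rep x Fin.≟ r) ⊙ G r)
      not-rep : ∀ r → rep r ≢ r → col r ≡ 0ℤ
      not-rep r ≢r = ∑-zero _ λ x → ⊙-no (rep x Fin.≟ r) _ λ eq →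
        ≢r (trans (cong rep (sym eq)) (trans (rep-rep x) eq))
      scale : ∀ {P : Set} (P? : Dec P) z → does P? ⊙ z ≡ z * (does P? ⊙ 1ℤ)
      scale (yes _) z = sym (ℤ.*-identityʳ z)
      scale (no _)  z = sym (ℤ.*-zeroʳ z)
      is-rep : ∀ r → rep r ≡ r → col r ≡ + size r * G r
      is-rep r eq = begin
        ∑ (λ x → does (rep x Fin.≟ r) ⊙ G r)
          ≡⟨ ∑-cong (λ x → trans (scale (rep x Fin.≟ r) (G r))
               (cong (λ b → G r * (b ⊙ 1ℤ)) (does-⇔ (flip-eq x) (rep x Fin.≟ r) (rep r Fin.≟ rep x)))) ⟩
        ∑ (λ x → G r * (does (rep r Fin.≟ rep x) ⊙ 1ℤ))
          ≡⟨ ∑-*ˡ (G r) _ ⟩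
        G r * ∑ (λ x → does (rep r Fin.≟ rep x) ⊙ 1ℤ)
          ≡⟨ cong (G r *_) (orbit-size r) ⟩
        G r * + size r  ≡⟨ ℤ.*-comm (G r) (+ size r) ⟩
        + size r * G r  ∎
        where
        flip-eq : ∀ x → (rep x ≡ r) ⇔ (rep r ≡ rep x)
        flip-eq x = mk⇔ (λ e → trans eq (sym e)) (λ e → trans (sym e) eq)

-- Subsets of Fin n

record Enumeration {n : ℕ} (P : Fin n → Set) (m : ℕ) : Set where
  field
    point           : Fin m → Fin n
    point-injective : Injective _≡_ _≡_ point
    point-∈         : ∀ i → P (point i)
    index           : ∀ {x} → P x → ∃[ i ] point i ≡ x

enumerate : ∀ {n} (B : Subset n) → Enumeration (_∈ B) ∣ B ∣
enumerate []            = record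
  { point = λ () ; point-injective = λ { {()} } ; point-∈ = λ () ; index = λ () }
enumerate (outside ∷ B) = record
  { point           = suc ∘ point
  ; point-injective = point-injective ∘ Fin.suc-injective
  ; point-∈         = there ∘ point-∈
  ; index           = λ { (there x∈B) → let i , eq = index x∈B in i , cong suc eq }
  }
  where open Enumeration (enumerate B)
enumerate (inside ∷ B)  = record
  { point           = λ { zero → zero ; (suc i) → suc (point i) }
  ; point-injective = λ { {zero} {zero} _ → refl
                        ; {suc _} {suc _} eq → cong suc (point-injective (Fin.suc-injective eq)) }
  ; point-∈         = λ { zero → here ; (suc i) → there (point-∈ i) }
  ; index           = λ { here        → zero , refl
                        ; (there x∈B) → let i , eq = index x∈B in suc i , cong suc eq }
  }
  where open Enumeration (enumerate B)

∣pair∣≡2 : ∀ {n} {x y : Fin n} → x ≢ y → ∣ ⁅ x ⁆ ∪ ⁅ y ⁆ ∣ ≡ 2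
∣pair∣≡2 {x = zero}  {zero}  x≢y = contradiction refl x≢y
∣pair∣≡2 {x = zero}  {suc y} x≢y = cong suc (trans (cong ∣_∣ (∪-identityˡ ⁅ y ⁆)) (∣⁅x⁆∣≡1 y))
∣pair∣≡2 {x = suc x} {zero}  x≢y = cong suc (trans (cong ∣_∣ (∪-identityʳ ⁅ x ⁆)) (∣⁅x⁆∣≡1 x))
∣pair∣≡2 {x = suc x} {suc y} x≢y = ∣pair∣≡2 (x≢y ∘ cong suc)

does-true : ∀ {P : Set} (P? : Dec P) → does P? ≡ true → P
does-true (yes p) _ = p

∈-image⁻ : ∀ {m n} (f : Fin m → Fin n) B {y} → y ∈ image f B → ∃[ x ] x ∈ B × f x ≡ y
∈-image⁻ f B {y} y∈ = does-true (Fin.any? _) (trans (sym (lookup∘tabulate _ y)) ([]=⇒lookup y∈))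

∈-image⁺ : ∀ {m n} (f : Fin m → Fin n) B {x} → x ∈ B → f x ∈ image f B
∈-image⁺ f B {x} x∈B = lookup⇒[]= (f x) (image f B)
  (trans (lookup∘tabulate _ (f x)) (dec-true (Fin.any? _) (x , x∈B , refl)))

-- The rotation of ℤ_v

toℕ-fold-shift : ∀ {n} (x : Fin (suc n)) i → toℕ (fold x shift i) ≡ (toℕ x ℕ.+ i) % suc n
toℕ-fold-shift {n} x zero    = sym (trans (cong (_% suc n) (ℕ.+-identityʳ (toℕ x))) (m<n⇒m%n≡m (Fin.toℕ<n x)))
toℕ-fold-shift {n} x (suc i) = begin
  toℕ (shift (fold x shift i))             ≡⟨ Fin.toℕ-fromℕ< _ ⟩
  suc (toℕ (fold x shift i)) % suc n       ≡⟨ cong (λ k → suc k % suc n) (toℕ-fold-shift x i) ⟩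
  (1 ℕ.+ (toℕ x ℕ.+ i) % suc n) % suc n    ≡⟨ %-distribˡ-+ 1 ((toℕ x ℕ.+ i) % suc n) (suc n) ⟩
  (1 % suc n ℕ.+ (toℕ x ℕ.+ i) % suc n % suc n) % suc n
    ≡⟨ cong (λ k → (1 % suc n ℕ.+ k) % suc n) (m%n%n≡m%n (toℕ x ℕ.+ i) (suc n)) ⟩
  (1 % suc n ℕ.+ (toℕ x ℕ.+ i) % suc n) % suc n
    ≡⟨ %-distribˡ-+ 1 (toℕ x ℕ.+ i) (suc n) ⟨
  suc (toℕ x ℕ.+ i) % suc n                ≡⟨ cong (_% suc n) (ℕ.+-suc (toℕ x) i) ⟨
  (toℕ x ℕ.+ suc i) % suc n                ∎

shift-period : ∀ {n} (x : Fin (suc n)) → Period shift (suc n) x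
shift-period {n} x = record
  { returns = Fin.toℕ-injective (begin
      toℕ (fold x shift (suc n))   ≡⟨ toℕ-fold-shift x (suc n) ⟩
      (toℕ x ℕ.+ suc n) % suc n    ≡⟨ [m+n]%n≡m%n (toℕ x) (suc n) ⟩
      toℕ x % suc n                ≡⟨ m<n⇒m%n≡m (Fin.toℕ<n x) ⟩
      toℕ x                        ∎)
  ; minimal = λ i eq → divides ((toℕ x ℕ.+ i) / suc n) (ℕ.+-cancelˡ-≡ (toℕ x) _ _ (begin
      toℕ x ℕ.+ i
        ≡⟨ m≡m%n+[m/n]*n (toℕ x ℕ.+ i) (suc n) ⟩
      (toℕ x ℕ.+ i) % suc n ℕ.+ (toℕ x ℕ.+ i) / suc n ℕ.* suc n
        ≡⟨ cong (ℕ._+ (toℕ x ℕ.+ i) / suc n ℕ.* suc n) (trans (sym (toℕ-fold-shift x i)) (cong toℕ eq)) ⟩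
      toℕ x ℕ.+ (toℕ x ℕ.+ i) / suc n ℕ.* suc n ∎))
  }

shift-injective : ∀ {n} → Injective _≡_ _≡_ (shift {suc n})
shift-injective {n} {x} {y} eq = begin
  x                     ≡⟨ Period.returns (shift-period x) ⟨
  fold x shift (suc n)  ≡⟨ fold-comm shift x n 1 ⟩
  fold (shift x) shift n  ≡⟨ cong (λ z → fold z shift n) eq ⟩
  fold (shift y) shift n  ≡⟨ fold-comm shift y n 1 ⟨
  fold y shift (suc n)  ≡⟨ Period.returns (shift-period y) ⟩
  y                     ∎

shift-transitive : ∀ {n} (x y : Fin (suc n)) → ∃[ i ] i < suc n × fold x shift i ≡ y
shift-transitive {n} x y = i % suc n , m%n<n i (suc n) , trans (sym (fold-% shift x i (Period.returns (shift-period x)))) (Fin.toℕ-injective (begin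
  toℕ (fold x shift i)       ≡⟨ toℕ-fold-shift x i ⟩
  (toℕ x ℕ.+ (suc n ℕ.∸ toℕ x ℕ.+ toℕ y)) % suc n ≡⟨ cong (_% suc n) (ℕ.+-assoc (toℕ x) _ (toℕ y)) ⟨
  (toℕ x ℕ.+ (suc n ℕ.∸ toℕ x) ℕ.+ toℕ y) % suc n ≡⟨ cong (λ k → (k ℕ.+ toℕ y) % suc n) (ℕ.m+[n∸m]≡n (ℕ.<⇒≤ (Fin.toℕ<n x))) ⟩
  (suc n ℕ.+ toℕ y) % suc n  ≡⟨ cong (_% suc n) (ℕ.+-comm (suc n) (toℕ y)) ⟩
  (toℕ y ℕ.+ suc n) % suc n  ≡⟨ [m+n]%n≡m%n (toℕ y) (suc n) ⟩
  toℕ y % suc n              ≡⟨ m<n⇒m%n≡m (Fin.toℕ<n y) ⟩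
  toℕ y                      ∎))
  -- The exponent is y - x modulo v; adding `suc n` first keeps the subtraction in ℕ.
  where i = suc n ℕ.∸ toℕ x ℕ.+ toℕ y

-- A cyclic Steiner triple system as an incidence relation on ℤ_v, together
-- with the map σ by which i ↦ i + 1 acts on the blocks.
record CyclicTriples (n b : ℕ) : Set₁ where
  infix 4 _∈ᴮ_ _∈ᴮ?_
  field
    _∈ᴮ_   : Fin (suc n) → Fin b → Set
    _∈ᴮ?_  : ∀ x j → Dec (x ∈ᴮ j)
    triple : ∀ j → Enumeration (_∈ᴮ j) 3
    join   : ∀ {x y} → x ≢ y → ∃[ j ] x ∈ᴮ j × y ∈ᴮ j
    unique : ∀ {x y j k} → x ≢ y → x ∈ᴮ j → y ∈ᴮ j → x ∈ᴮ k → y ∈ᴮ k → j ≡ k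
    σ      : Fin b → Fin b
    ∈-σ⁺   : ∀ {x j} → x ∈ᴮ j → shift x ∈ᴮ σ j
    ∈-σ⁻   : ∀ {x j} → shift x ∈ᴮ σ j → x ∈ᴮ j

-- Only the points are relabelled, through the inverse of π; blocks keep their indices. The second
-- component therefore carries a flow on the relabelled system back to `D` with the same values.
cyclicTriples : ∀ {n} (D : Design (suc n)) → IsSteinerTripleSystem D → ((π , _) : IsCyclic D) →
  Σ[ C ∈ CyclicTriples n (Design.#blocks D) ]
    (∀ x j → does (x ∈? Design.block D j) ≡ does (CyclicTriples._∈ᴮ?_ C (π ⟨$⟩ʳ x) j))
cyclicTriples {n} D S (π , cyc) = C , λ x j →
  cong (λ z → does (z ∈? block j)) (sym (inverseˡ π))
  where
  open Design D
  open IsSteinerTripleSystem S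
  module E j = Enumeration (subst (Enumeration (_∈ block j)) (block-size j) (enumerate (block j)))

  unrelabel : ∀ {x y} → π ⟨$⟩ʳ x ≡ y → x ≡ π ⟨$⟩ˡ y
  unrelabel eq = trans (sym (inverseˡ π)) (cong (π ⟨$⟩ˡ_) eq)

  ˡ-injective : ∀ {x y} → π ⟨$⟩ˡ x ≡ π ⟨$⟩ˡ y → x ≡ y
  ˡ-injective eq = trans (sym (inverseʳ π)) (trans (cong (π ⟨$⟩ʳ_) eq) (inverseʳ π))

  pair-⊆ : ∀ {x y} {B : Subset (suc n)} → x ∈ B → y ∈ B → ⁅ x ⁆ ∪ ⁅ y ⁆ ⊆ B
  pair-⊆ {x} {y} {B} x∈B y∈B z∈ with x∈p∪q⁻ ⁅ x ⁆ ⁅ y ⁆ z∈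
  ... | inj₁ z∈x = subst (_∈ B) (sym (x∈⁅y⁆⇒x≡y x z∈x)) x∈B
  ... | inj₂ z∈y = subst (_∈ B) (sym (x∈⁅y⁆⇒x≡y y z∈y)) y∈B

  C : CyclicTriples n #blocks
  C = record
    { _∈ᴮ_   = λ x j → π ⟨$⟩ˡ x ∈ block j
    ; _∈ᴮ?_  = λ x j → π ⟨$⟩ˡ x ∈? block j
    ; triple = λ j → record
      { point           = (π ⟨$⟩ʳ_) ∘ E.point j
      ; point-injective = λ eq → E.point-injective j
          (trans (sym (inverseˡ π)) (trans (cong (π ⟨$⟩ˡ_) eq) (inverseˡ π)))
      ; point-∈         = λ i → subst (_∈ block j) (sym (inverseˡ π)) (E.point-∈ j i)
      ; index           = λ x∈ → let i , eq = E.index j x∈ in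
          i , trans (cong (π ⟨$⟩ʳ_) eq) (inverseʳ π)
      }
    ; join   = λ {x} {y} x≢y →
        let j , ⊆j , _ = pair-covered (⁅ π ⟨$⟩ˡ x ⁆ ∪ ⁅ π ⟨$⟩ˡ y ⁆) (∣pair∣≡2 (x≢y ∘ ˡ-injective))
        in j , ⊆j (x∈p∪q⁺ (inj₁ (x∈⁅x⁆ _))) , ⊆j (x∈p∪q⁺ (inj₂ (x∈⁅x⁆ _)))
    ; unique = λ {x} {y} x≢y x∈j y∈j x∈k y∈k →
        let _ , _ , ! = pair-covered (⁅ π ⟨$⟩ˡ x ⁆ ∪ ⁅ π ⟨$⟩ˡ y ⁆) (∣pair∣≡2 (x≢y ∘ ˡ-injective))
        in trans (sym (! (pair-⊆ x∈j y∈j))) (! (pair-⊆ x∈k y∈k))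
    ; σ      = λ j → proj₁ (cyc j)
    ; ∈-σ⁺   = λ {x} {j} x∈j →
        let k , eq = cyc j
            u , u∈k , πu≡ = ∈-image⁻ (π ⟨$⟩ʳ_) (block k) (subst (shift x ∈_) eq
              (∈-image⁺ shift _ (subst (_∈ image (π ⟨$⟩ʳ_) (block j)) (inverseʳ π)
                (∈-image⁺ (π ⟨$⟩ʳ_) (block j) x∈j))))
        in subst (_∈ block k) (unrelabel πu≡) u∈k
    ; ∈-σ⁻   = λ {x} {j} σx∈k →
        let k , eq = cyc j
            z , z∈ , sz≡ = ∈-image⁻ shift (image (π ⟨$⟩ʳ_) (block j)) (subst (shift x ∈_) (sym eq)
              (subst (_∈ image (π ⟨$⟩ʳ_) (block k)) (inverseʳ π) (∈-image⁺ (π ⟨$⟩ʳ_) (block k) σx∈k)))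
            u , u∈j , πu≡ = ∈-image⁻ (π ⟨$⟩ʳ_) (block j) z∈
        in subst (_∈ block j) (unrelabel (trans πu≡ (shift-injective sz≡))) u∈j
    }

-- Since n + 1 steps are the identity, n steps invert one step.
rotation : ∀ {m} (f : Fin m → Fin m) n → (∀ x → fold x f (suc n) ≡ x) → Permutation′ m
rotation f n f^v = permutation f (λ x → fold x f n)
  f^v (λ x → trans (fold-comm f x 1 n) (f^v x))

∑-enumeration : ∀ {n m} {P : Fin n → Set} (P? : Decidable P) (E : Enumeration P m) x z →
  does (P? x) ⊙ z ≡ ∑ (λ k → does (Enumeration.point E k Fin.≟ x) ⊙ z)
∑-enumeration P? E x z = sym (⊙-dec (P? x) _ z
  (λ Px → let i , eq = index Px in
    trans (∑-single _ i λ k k≢i → ⊙-no (point k Fin.≟ x) z λ eq′ → k≢i (point-injective (trans eq′ (sym eq))))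
          (⊙-yes (point i Fin.≟ x) z eq))
  (λ ¬Px → ∑-zero _ λ k → ⊙-no (point k Fin.≟ x) z λ { refl → ¬Px (point-∈ k) }))
  where open Enumeration E

∑-restrict : ∀ {n m} {P : Fin n → Set} (P? : Decidable P) (E : Enumeration P m) (h : Fin n → ℤ) →
  ∑ (λ x → does (P? x) ⊙ h x) ≡ ∑ (λ k → h (Enumeration.point E k))
∑-restrict P? E h = begin
  ∑ (λ x → does (P? x) ⊙ h x)                        ≡⟨ ∑-cong (λ x → ∑-enumeration P? E x (h x)) ⟩
  ∑ (λ x → ∑ (λ k → does (point k Fin.≟ x) ⊙ h x))   ≡⟨ ∑-swap _ ⟩
  ∑ (λ k → ∑ (λ x → does (point k Fin.≟ x) ⊙ h x))   ≡⟨ ∑-cong (λ k → ∑-δ (point k) h) ⟩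
  ∑ (λ k → h (point k))                              ∎
  where open Enumeration E

-- Stabilizers and double counting in a cyclic triple system

module Cyclic {n b : ℕ} (C : CyclicTriples n b) where
  open CyclicTriples C public
  module T j = Enumeration (triple j)

  v : ℕ
  v = suc n

  fold-∈⁺ : ∀ {x j} i → x ∈ᴮ j → fold x shift i ∈ᴮ fold j σ i
  fold-∈⁺ zero    x∈j = x∈j
  fold-∈⁺ (suc i) x∈j = ∈-σ⁺ (fold-∈⁺ i x∈j)

  fold-∈⁻ : ∀ {x j} i → fold x shift i ∈ᴮ fold j σ i → x ∈ᴮ j
  fold-∈⁻ zero    x∈j = x∈j
  fold-∈⁻ (suc i) x∈j = fold-∈⁻ i (∈-σ⁻ x∈j)

  -- Two distinct points of `j` already determine the block, so one inclusion suffices.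
  block-ext : ∀ {j k} → (∀ {x} → x ∈ᴮ j → x ∈ᴮ k) → j ≡ k
  block-ext {j} {k} j⊆k = unique
    (λ eq → contradiction (T.point-injective j {zero} {suc zero} eq) λ ())
    (T.point-∈ j _) (T.point-∈ j _) (j⊆k (T.point-∈ j _)) (j⊆k (T.point-∈ j _))

  σ-injective : Injective _≡_ _≡_ σ
  σ-injective eq = block-ext λ x∈j → ∈-σ⁻ (subst (_ ∈ᴮ_) eq (∈-σ⁺ x∈j))

  σ^v : ∀ j → fold j σ v ≡ j
  σ^v j = sym (block-ext λ {x} x∈j →
    subst (_∈ᴮ fold j σ v) (Period.returns (shift-period x)) (fold-∈⁺ v x∈j))

  open Representatives σ σ-injective v σ^v public

  fold-shift-surjective : ∀ i (y : Fin v) → ∃[ x ] fold x shift i ≡ y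
  -- Together with the i steps this makes i + i n = i v steps, that is, full turns.
  fold-shift-surjective i y = fold y shift (i ℕ.* n) , (begin
    fold (fold y shift (i ℕ.* n)) shift i  ≡⟨ fold-+ y shift i ⟨
    fold y shift (i ℕ.+ i ℕ.* n)
      ≡⟨ fold-∣ shift y (Period.returns (shift-period y)) (divides i (sym (ℕ.*-suc i n))) ⟩
    y                                      ∎)

  rotated-triple : ∀ j i → Enumeration (_∈ᴮ fold j σ i) 3
  rotated-triple j i = record
    { point           = λ k → fold (T.point j k) shift i
    ; point-injective = T.point-injective j ∘ Orbits.fold-injective shift shift-injective i
    ; point-∈         = λ k → fold-∈⁺ i (T.point-∈ j k)
    ; index           = index
    }
    where
    index : ∀ {y} → y ∈ᴮ fold j σ i → ∃[ k ] fold (T.point j k) shift i ≡ y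
    index {y} y∈ with fold-shift-surjective i y
    ... | x , refl with T.index j (fold-∈⁻ {x} {j} i y∈)
    ...   | k , refl = k , refl

  -- With a in the block, a, a + i, a + 2i and a + 3i all lie in it, so two of them coincide.
  stabilizer : ∀ {m} → n ≡ m ℕ.* 2 → ∀ j i → fold j σ i ≡ j → v ∣ 3 ℕ.* i
  stabilizer {m} n≡2m j i σⁱj≡j =
    let s , t , s<t , same = Fin.pigeonhole ℕ.≤-refl (λ s → proj₁ (hit s))
    in from-collision s t s<t (trans (sym (proj₂ (hit s))) (trans (cong (T.point j) same) (proj₂ (hit t))))
    where
    a : Fin v
    a = T.point j zero
    hit : ∀ (s : Fin 4) → ∃[ k ] T.point j k ≡ fold a shift (toℕ s ℕ.* i)
    hit s = T.index j (subst (_ ∈ᴮ_) (fold-∣ σ j σⁱj≡j (divides (toℕ s) refl))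
      (fold-∈⁺ (toℕ s ℕ.* i) (T.point-∈ j zero)))
    -- As v = 2m + 1 is odd, m + 1 inverts 2 modulo v. Hence a collision at distance 2 gives v ∣ i
    -- just as one at distance 1 does; distance 3 gives the claim directly.
    double : ∀ m i → suc m ℕ.* (2 ℕ.* i) ≡ i ℕ.* suc (m ℕ.* 2) ℕ.+ i
    double = ℕSolver.solve-∀
    small-multiple : ∀ d → d ≢ 0 → d < 4 → v ∣ d ℕ.* i → v ∣ 3 ℕ.* i
    small-multiple 0 d≢0 _ _  = contradiction refl d≢0
    small-multiple 1 _   _ v∣ = ∣.∣n⇒∣m*n 3 (subst (v ∣_) (ℕ.*-identityˡ i) v∣)
    small-multiple 2 _   _ v∣ = ∣.∣n⇒∣m*n 3 (∣.∣m+n∣m⇒∣n (subst (v ∣_) (double m i) (∣.∣n⇒∣m*n (suc m) v∣))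
      (subst (_∣ i ℕ.* suc (m ℕ.* 2)) (cong suc (sym n≡2m)) (∣.∣n⇒∣m*n i ∣.∣-refl)))
    small-multiple 3 _   _ v∣ = v∣
    small-multiple (suc (suc (suc (suc _)))) _ (s≤s (s≤s (s≤s (s≤s ())))) _
    from-collision : ∀ (s t : Fin 4) → toℕ s < toℕ t →
      fold a shift (toℕ s ℕ.* i) ≡ fold a shift (toℕ t ℕ.* i) → v ∣ 3 ℕ.* i
    from-collision s t s<t eq = small-multiple (toℕ t ℕ.∸ toℕ s)
      (ℕ.m>n⇒m∸n≢0 s<t)
      (ℕ.≤-<-trans (ℕ.m∸n≤m (toℕ t) (toℕ s)) (Fin.toℕ<n t))
      (subst (v ∣_) (sym (ℕ.*-distribʳ-∸ i (toℕ t) (toℕ s)))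
        (Orbits.period-∣-∸ shift shift-injective (shift-period a) (ℕ.*-monoˡ-≤ i (ℕ.<⇒≤ s<t)) eq))

  flux : (Fin b → ℤ) → Fin v → ℤ
  flux f x = ∑ (λ j → does (x ∈ᴮ? j) ⊙ f j)

  flux-shift : ∀ f → (∀ j → f (σ j) ≡ f j) → ∀ x → flux f (shift x) ≡ flux f x
  flux-shift f fσ x = begin
    ∑ (λ j → does (shift x ∈ᴮ? j) ⊙ f j)          ≡⟨ ∑-reindex _ (rotation σ n σ^v) ⟩
    ∑ (λ j → does (shift x ∈ᴮ? σ j) ⊙ f (σ j))
      ≡⟨ ∑-cong (λ j → cong₂ _⊙_ (does-⇔ (mk⇔ ∈-σ⁻ ∈-σ⁺) (shift x ∈ᴮ? σ j) (x ∈ᴮ? j)) (fσ j)) ⟩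
    ∑ (λ j → does (x ∈ᴮ? j) ⊙ f j)                ∎

  flux-constant : ∀ f → (∀ j → f (σ j) ≡ f j) → ∀ x y → flux f y ≡ flux f x
  flux-constant f fσ x y with shift-transitive x y
  ... | i , _ , refl = along i
    where
    along : ∀ i → flux f (fold x shift i) ≡ flux f x
    along zero    = refl
    along (suc i) = trans (flux-shift f fσ (fold x shift i)) (along i)

  -- Incident pairs are counted twice: by points, where the flux is the same everywhere, and by
  -- blocks, each of which has three points.
  v*flux : ∀ f → (∀ j → f (σ j) ≡ f j) → ∀ x → + v * flux f x ≡ + 3 * ∑ f
  v*flux f fσ x = begin
    + v * flux f x                                   ≡⟨ ∑-const v (flux f x) ⟨
    ∑ {v} (λ y → flux f x)                           ≡⟨ ∑-cong (λ y → flux-constant f fσ y x) ⟩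
    ∑ (λ y → ∑ (λ j → does (y ∈ᴮ? j) ⊙ f j))         ≡⟨ ∑-swap _ ⟩
    ∑ (λ j → ∑ (λ y → does (y ∈ᴮ? j) ⊙ f j))
      ≡⟨ ∑-cong (λ j → trans (∑-restrict (_∈ᴮ? j) (triple j) (λ _ → f j)) (∑-const 3 (f j))) ⟩
    ∑ (λ j → + 3 * f j)                              ≡⟨ ∑-*ˡ (+ 3) f ⟩
    + 3 * ∑ f                                        ∎

  -- Every ordered pair of distinct points lies in exactly one block. A pair (x, x) occurs in each
  -- block through x, hence the requirement that ω vanish on the diagonal.
  ∑-pairs : ∀ (ω : Fin v → Fin v → ℤ) → (∀ x → ω x x ≡ 0ℤ) →
    ∑ (λ j → ∑ (λ k → ∑ (λ l → ω (T.point j k) (T.point j l)))) ≡ ∑ (λ x → ∑ (ω x))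
  ∑-pairs ω ω-diag = begin
    ∑ (λ j → ∑ (λ k → ∑ (λ l → ω (T.point j k) (T.point j l))))
      ≡⟨ ∑-cong (λ j → ∑-cong λ k → sym (∑-restrict (_∈ᴮ? j) (triple j) (ω (T.point j k)))) ⟩
    ∑ (λ j → ∑ (λ k → ∑ (λ y → does (y ∈ᴮ? j) ⊙ ω (T.point j k) y)))
      ≡⟨ ∑-cong (λ j → sym (∑-restrict (_∈ᴮ? j) (triple j) λ x → ∑ (λ y → does (y ∈ᴮ? j) ⊙ ω x y))) ⟩
    ∑ (λ j → ∑ (λ x → does (x ∈ᴮ? j) ⊙ ∑ (λ y → does (y ∈ᴮ? j) ⊙ ω x y)))
      ≡⟨ ∑-cong (λ j → ∑-cong λ x → sym (∑-⊙ (does (x ∈ᴮ? j)) λ y → does (y ∈ᴮ? j) ⊙ ω x y)) ⟩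
    ∑ (λ j → ∑ (λ x → ∑ (λ y → term x y j)))
      ≡⟨ ∑-swap _ ⟩
    ∑ (λ x → ∑ (λ j → ∑ (λ y → term x y j)))
      ≡⟨ ∑-cong (λ x → ∑-swap _) ⟩
    ∑ (λ x → ∑ (λ y → ∑ (term x y)))
      ≡⟨ ∑-cong (λ x → ∑-cong λ y → only-one x y) ⟩
    ∑ (λ x → ∑ (ω x))
      ∎
    where
    term : Fin v → Fin v → Fin b → ℤ
    term x y j = does (x ∈ᴮ? j) ⊙ does (y ∈ᴮ? j) ⊙ ω x y
    only-one : ∀ x y → ∑ (term x y) ≡ ω x y
    only-one x y with x Fin.≟ y
    ... | yes refl = trans
      (∑-zero _ λ j → trans (cong (λ z → d j ⊙ d j ⊙ z) (ω-diag x)) (trans (cong (d j ⊙_) (⊙-zeroʳ (d j))) (⊙-zeroʳ (d j))))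
      (sym (ω-diag x))
      where
      d : Fin b → Bool
      d j = does (x ∈ᴮ? j)
    ... | no x≢y with join x≢y
    ...   | j₀ , x∈j₀ , y∈j₀ = trans
      (∑-single (term x y) j₀ λ j j≢j₀ → off j j≢j₀)
      (trans (⊙-yes (x ∈ᴮ? j₀) _ x∈j₀) (⊙-yes (y ∈ᴮ? j₀) _ y∈j₀))
      where
      off : ∀ j → j ≢ j₀ → term x y j ≡ 0ℤ
      off j j≢j₀ with x ∈ᴮ? j
      ... | no _    = refl
      ... | yes x∈j = ⊙-no (y ∈ᴮ? j) _ λ y∈j → j≢j₀ (unique x≢y x∈j y∈j x∈j₀ y∈j₀)

  -- `∑-pairs` with weight 1 off the diagonal and 0 on it: a block holds 6 ordered pairs, and each
  -- point starts n of them.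
  6*blocks : + 6 * + b ≡ + v * + n
  6*blocks = begin
    + 6 * + b                 ≡⟨ ℤ.*-comm (+ 6) (+ b) ⟩
    + b * + 6                 ≡⟨ ∑-const b (+ 6) ⟨
    ∑ {b} (λ j → + 6)         ≡⟨ ∑-cong (λ j → sym (block-sum j)) ⟩
    ∑ (λ j → ∑ (λ k → ∑ (λ l → ω (T.point j k) (T.point j l))))
                              ≡⟨ ∑-pairs ω ω-diag ⟩
    ∑ (λ x → ∑ (ω x))         ≡⟨ ∑-cong row ⟩
    ∑ {v} (λ x → + n)         ≡⟨ ∑-const v (+ n) ⟩
    + v * + n                 ∎
    where
    δ : ∀ {m} → Fin m → Fin m → ℤ
    δ x y = does (x Fin.≟ y) ⊙ -1ℤ
    ω : Fin v → Fin v → ℤ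
    ω x y = 1ℤ + δ x y
    ω-diag : ∀ x → ω x x ≡ 0ℤ
    ω-diag x = cong (_+_ 1ℤ) (⊙-yes (x Fin.≟ x) -1ℤ refl)
    row-sum : ∀ {m} (x : Fin (suc m)) → ∑ (λ y → 1ℤ + δ x y) ≡ + m
    row-sum {m} x = begin
      ∑ (λ y → 1ℤ + δ x y)                 ≡⟨ ∑-+ (λ _ → 1ℤ) (δ x) ⟩
      ∑ {suc m} (λ _ → 1ℤ) + ∑ (δ x)       ≡⟨ cong₂ _+_ (∑-const (suc m) 1ℤ) (∑-δ x λ _ → -1ℤ) ⟩
      + suc m * 1ℤ + -1ℤ                   ≡⟨ cong (λ z → z + -1ℤ) (ℤ.*-identityʳ (+ suc m)) ⟩
      + m                                  ∎
    row : ∀ x → ∑ (ω x) ≡ + n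
    row = row-sum
    block-sum : ∀ j → ∑ (λ k → ∑ (λ l → ω (T.point j k) (T.point j l))) ≡ + 6
    block-sum j = trans
      (∑-cong λ k → trans
        (∑-cong λ l → cong (λ b → 1ℤ + b ⊙ -1ℤ)
          (does-⇔ (mk⇔ (T.point-injective j) (cong (T.point j))) (T.point j k Fin.≟ T.point j l) (k Fin.≟ l)))
        (row-sum k))
      (∑-const 3 (+ 2))

-- Flows assembled orbit by orbit

⊙-∧-* : ∀ a b y z → a ⊙ (y * (b ⊙ z)) ≡ y * ((a ∧ b) ⊙ z)
⊙-∧-* true  b y z = refl
⊙-∧-* false b y z = sym (ℤ.*-zeroʳ y)

module _ {n b : ℕ} (C : CyclicTriples n b) where
  open Cyclic C

  NowhereZero3Flow : Set
  NowhereZero3Flow = Σ[ f ∈ (Fin b → ℤ) ] (∀ j → Small (f j)) × (∀ x → flux f x ≡ 0ℤ)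

  -- A rotate of `j` contains `x` exactly when it carries one of the three points of `j` to `x`, and
  -- for each of these points exactly one exponent below v does so.
  rotated-flux : ∀ j (c : ℕ → ℤ) x →
    ∑ {v} (λ i → does (x ∈ᴮ? fold j σ (toℕ i)) ⊙ c (toℕ i)) ≡
    ∑ (λ k → c (proj₁ (shift-transitive (T.point j k) x)))
  rotated-flux j c x = begin
    ∑ {v} (λ i → does (x ∈ᴮ? fold j σ (toℕ i)) ⊙ c (toℕ i))
      ≡⟨ ∑-cong {v} (λ i → ∑-enumeration (_∈ᴮ? fold j σ (toℕ i)) (rotated-triple j (toℕ i)) x (c (toℕ i))) ⟩
    ∑ {v} (λ i → ∑ (λ k → does (fold (T.point j k) shift (toℕ i) Fin.≟ x) ⊙ c (toℕ i)))
      ≡⟨ ∑-swap {v} {3} (λ i k → does (fold (T.point j k) shift (toℕ i) Fin.≟ x) ⊙ c (toℕ i)) ⟩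
    ∑ (λ k → ∑ {v} (λ i → does (fold (T.point j k) shift (toℕ i) Fin.≟ x) ⊙ c (toℕ i)))
      ≡⟨ ∑-cong (λ k → let _ , i<v , eq = shift-transitive (T.point j k) x in
           Orbits.∑-orbit shift shift-injective Fin._≟_ (shift-period (T.point j k)) c x i<v eq) ⟩
    ∑ (λ k → c (proj₁ (shift-transitive (T.point j k) x)))
      ∎

  -- The flow takes the value c i on σⁱ j₀, contributing K at every point, and
  -- the constant g r on every other orbit, r being its representative.
  flow-from-orbits :
    ∀ j₀ → Period σ v j₀ →
    ∀ (c : ℕ → ℤ) K → (∀ i → Small (c i)) →
    (∀ x → ∑ (λ k → c (proj₁ (shift-transitive (T.point j₀ k) x))) ≡ K) →
    ∀ (size : Fin b → ℕ) → (∀ j → NonZero (size j)) → (∀ j → Period σ (size j) j) →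
    ∀ (g : Fin b → ℤ) → (∀ r → Small (g r)) →
    + v * K + + 3 * ∑ (λ r → does (rep r Fin.≟ r) ⊙ (+ size r * (does (¬? (r Fin.≟ rep j₀)) ⊙ g r))) ≡ 0ℤ →
    NowhereZero3Flow
  flow-from-orbits j₀ j₀-period c K c-small c-flux size size≢0 period g g-small balance =
    (λ j → f₁ j + f₀ j) , small , zero-flux
    where
    f₁ f₀ G : Fin b → ℤ
    -- The delta terms recover the exponent i from σⁱ j₀. `f₁` vanishes off the orbit of `j₀` and
    -- `f₀` vanishes on it, so their sum takes one of the prescribed small values at every block.
    f₁ j = ∑ {v} (λ i → does (fold j₀ σ (toℕ i) Fin.≟ j) ⊙ c (toℕ i))
    G r  = does (¬? (r Fin.≟ rep j₀)) ⊙ g r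
    f₀ j = G (rep j)

    small : ∀ j → Small (f₁ j + f₀ j)
    small j with rep j Fin.≟ rep j₀
    ... | yes eq =
      let i , i<v , eqᵢ = reduce (rep-injective {j₀} {j} (sym eq))
      in subst Small (sym (trans (ℤ.+-identityʳ (f₁ j))
           (Orbits.∑-orbit σ σ-injective Fin._≟_ j₀-period c j i<v eqᵢ))) (c-small i)
    ... | no ≢ = subst Small (sym (trans
      (cong (λ z → z + g (rep j)) (Orbits.∑-outside-orbit σ σ-injective Fin._≟_ {v} {j₀} c j
        λ i eqᵢ → ≢ (sym (rep-cong (i , eqᵢ)))))
      (ℤ.+-identityˡ (g (rep j))))) (g-small (rep j))

    flux-f₁ : ∀ x → flux f₁ x ≡ K
    flux-f₁ x = begin
      ∑ (λ j → does (x ∈ᴮ? j) ⊙ f₁ j)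
        ≡⟨ ∑-cong (λ j → sym (∑-⊙ (does (x ∈ᴮ? j)) _)) ⟩
      ∑ (λ j → ∑ {v} (λ i → does (x ∈ᴮ? j) ⊙ does (fold j₀ σ (toℕ i) Fin.≟ j) ⊙ c (toℕ i)))
        ≡⟨ ∑-swap {b} {v} _ ⟩
      ∑ {v} (λ i → ∑ (λ j → does (x ∈ᴮ? j) ⊙ does (fold j₀ σ (toℕ i) Fin.≟ j) ⊙ c (toℕ i)))
        ≡⟨ ∑-cong {v} (λ i → ∑-cong λ j → ⊙-comm (does (x ∈ᴮ? j)) _ (c (toℕ i))) ⟩
      ∑ {v} (λ i → ∑ (λ j → does (fold j₀ σ (toℕ i) Fin.≟ j) ⊙ does (x ∈ᴮ? j) ⊙ c (toℕ i)))
        ≡⟨ ∑-cong {v} (λ i → ∑-δ (fold j₀ σ (toℕ i)) λ j → does (x ∈ᴮ? j) ⊙ c (toℕ i)) ⟩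
      ∑ {v} (λ i → does (x ∈ᴮ? fold j₀ σ (toℕ i)) ⊙ c (toℕ i))
        ≡⟨ rotated-flux j₀ c x ⟩
      ∑ (λ k → c (proj₁ (shift-transitive (T.point j₀ k) x)))
        ≡⟨ c-flux x ⟩
      K ∎

    zero-flux : ∀ x → flux (λ j → f₁ j + f₀ j) x ≡ 0ℤ
    -- `f₀` is constant on orbits, and `v*flux` gives v times its flux; so the whole equation is
    -- multiplied by v, where it becomes `balance`.
    zero-flux x = ℤ.*-cancelˡ-≡ (+ v) _ 0ℤ (begin
      + v * flux (λ j → f₁ j + f₀ j) x
        ≡⟨ cong (+ v *_) (trans (∑-cong λ j → ⊙-distribˡ-+ (does (x ∈ᴮ? j)) (f₁ j) (f₀ j)) (∑-+ _ _)) ⟩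
      + v * (flux f₁ x + flux f₀ x)
        ≡⟨ ℤ.*-distribˡ-+ (+ v) (flux f₁ x) (flux f₀ x) ⟩
      + v * flux f₁ x + + v * flux f₀ x
        ≡⟨ cong₂ _+_ (cong (+ v *_) (flux-f₁ x))
             (v*flux f₀ (λ j → cong G (sym (rep-cong (1 , refl)))) x) ⟩
      + v * K + + 3 * ∑ f₀
        ≡⟨ cong (λ z → + v * K + + 3 * z) (∑-over-orbits size size≢0 period G) ⟩
      + v * K + + 3 * ∑ (λ r → does (rep r Fin.≟ r) ⊙ (+ size r * G r))
        ≡⟨ balance ⟩
      0ℤ       ≡⟨ ℤ.*-zeroʳ (+ v) ⟨
      + v * 0ℤ ∎)

  -- v ≡ 1 (mod 6): all orbits have v blocks

  module _ {k} (n≡6k : n ≡ k ℕ.* 6) where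

    -- The number 3 is invertible modulo v = 6k + 1: from v ∣ 3i, given by `stabilizer`, and i v =
    -- 2k (3i) + i it follows that v ∣ i.
    free : ∀ j → Period σ v j
    free j = record
      { returns = σ^v j
      ; minimal = λ i eq → ∣.∣m+n∣m⇒∣n
          (subst (v ∣_) (trans (cong (λ n → i ℕ.* suc n) n≡6k) (split k i)) (∣.∣n⇒∣m*n i ∣.∣-refl))
          (∣.∣n⇒∣m*n (2 ℕ.* k) (stabilizer {3 ℕ.* k} (trans n≡6k (even k)) j i eq))
      }
      where
      split : ∀ k i → i ℕ.* suc (k ℕ.* 6) ≡ 2 ℕ.* k ℕ.* (3 ℕ.* i) ℕ.+ i
      split = ℕSolver.solve-∀
      even : ∀ k → k ℕ.* 6 ≡ 3 ℕ.* k ℕ.* 2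
      even = ℕSolver.solve-∀

    -- A single orbit would mean b = v, and then 6 b = v n forces n = 6.
    other-orbit : v ≢ 7 → ∀ j₀ → ∃[ r ] rep r ≡ r × r ≢ rep j₀
    other-orbit v≢7 j₀ with Fin.any? (λ r → (rep r Fin.≟ r) ×-dec ¬? (r Fin.≟ rep j₀))
    ... | yes r = r
    ... | no ∄r = contradiction (cong suc (ℤ.+-injective (ℤ.*-cancelˡ-≡ (+ v) _ _ v*n≡v*6))) v≢7
      where
      b≡v : + b ≡ + v
      b≡v = begin
        + b                ≡⟨ ℤ.*-identityʳ (+ b) ⟨
        + b * 1ℤ           ≡⟨ ∑-const b 1ℤ ⟨
        ∑ {b} (λ _ → 1ℤ)   ≡⟨ ∑-over-orbits (λ _ → v) (λ _ → _) free (λ _ → 1ℤ) ⟩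
        ∑ (λ r → does (rep r Fin.≟ r) ⊙ (+ v * 1ℤ))
          ≡⟨ ∑-single _ (rep j₀) (λ r r≢ → ⊙-no (rep r Fin.≟ r) _ λ r-rep → ∄r (r , r-rep , r≢)) ⟩
        does (rep (rep j₀) Fin.≟ rep j₀) ⊙ (+ v * 1ℤ)
          ≡⟨ ⊙-yes (rep (rep j₀) Fin.≟ rep j₀) _ (rep-rep j₀) ⟩
        + v * 1ℤ           ≡⟨ ℤ.*-identityʳ (+ v) ⟩
        + v                ∎
      v*n≡v*6 : + v * + n ≡ + v * + 6
      v*n≡v*6 = trans (sym 6*blocks) (trans (cong (+ 6 *_) b≡v) (ℤ.*-comm (+ 6) (+ v)))

    flow-1mod6 : v ≢ 7 → Fin b → NowhereZero3Flow
    flow-1mod6 v≢7 j₀ =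
      let r , r-rep , r≢ = other-orbit v≢7 j₀
          g , g-small , ∑g = small-sum (λ r → (rep r Fin.≟ r) ×-dec ¬? (r Fin.≟ rep j₀)) -1ℤ
                               (r , r-rep , r≢) (from-yes (small? -1ℤ))
      -- The constant 1 on the first orbit contributes 3 at each point; the other orbits, with total
      -- -1 and v blocks each, contribute -3.
      in flow-from-orbits j₀ (free j₀) (λ _ → 1ℤ) (+ 3) (λ _ → small-1) (λ x → ∑-const 3 1ℤ)
           (λ _ → v) (λ _ → _) free g g-small
           (trans (cong (λ z → + v * + 3 + + 3 * z) (begin
               ∑ (λ r → does (rep r Fin.≟ r) ⊙ (+ v * (does (¬? (r Fin.≟ rep j₀)) ⊙ g r)))
                 ≡⟨ ∑-cong (λ r → ⊙-∧-* (does (rep r Fin.≟ r)) _ (+ v) (g r)) ⟩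
               ∑ (λ r → + v * (does ((rep r Fin.≟ r) ×-dec ¬? (r Fin.≟ rep j₀)) ⊙ g r))
                 ≡⟨ ∑-*ˡ (+ v) _ ⟩
               + v * ∑ (λ r → does ((rep r Fin.≟ r) ×-dec ¬? (r Fin.≟ rep j₀)) ⊙ g r)
                 ≡⟨ cong (+ v *_) ∑g ⟩
               + v * -1ℤ ∎))
             (cancel (+ v)))
      where
      cancel : ∀ z → z * + 3 + + 3 * (z * -1ℤ) ≡ 0ℤ
      cancel = solve-∀

-- Residues modulo 3

mod₃ : ℕ → Fin 3
mod₃ m = m mod 3

infixl 6 _⊞_
_⊞_ : Fin 3 → Fin 3 → Fin 3
α ⊞ β = mod₃ (toℕ α ℕ.+ toℕ β)

toℕ-mod₃ : ∀ a → toℕ (mod₃ a) ≡ a % 3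
toℕ-mod₃ a = Fin.toℕ-fromℕ< (m%n<n a 3)

mod₃-cong : ∀ {a b} → a % 3 ≡ b % 3 → mod₃ a ≡ mod₃ b
mod₃-cong {a} {b} eq = Fin.toℕ-injective (trans (toℕ-mod₃ a) (trans eq (sym (toℕ-mod₃ b))))

mod₃-+ : ∀ a b → mod₃ (a ℕ.+ b) ≡ mod₃ a ⊞ mod₃ b
mod₃-+ a b = mod₃-cong {a ℕ.+ b} {toℕ (mod₃ a) ℕ.+ toℕ (mod₃ b)} (begin
  (a ℕ.+ b) % 3                            ≡⟨ %-distribˡ-+ a b 3 ⟩
  (a % 3 ℕ.+ b % 3) % 3                    ≡⟨ cong₂ (λ x y → (x ℕ.+ y) % 3) (toℕ-mod₃ a) (toℕ-mod₃ b) ⟨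
  (toℕ (mod₃ a) ℕ.+ toℕ (mod₃ b)) % 3      ∎)

⊞-cancelʳ : ∀ γ α β → α ⊞ γ ≡ β ⊞ γ → α ≡ β
⊞-cancelʳ = from-yes (Fin.all? λ γ → Fin.all? λ α → Fin.all? λ β →
  (α ⊞ γ Fin.≟ β ⊞ γ) →-dec (α Fin.≟ β))

⊞-identityʳ : ∀ α → α ⊞ zero ≡ α
⊞-identityʳ = from-yes (Fin.all? λ α → α ⊞ zero Fin.≟ α)

Distinct : Fin 3 → Fin 3 → Fin 3 → Set
Distinct α β γ = α ≢ β × α ≢ γ × β ≢ γ

distinct? : ∀ α β γ → Dec (Distinct α β γ)
distinct? α β γ = ¬? (α Fin.≟ β) ×-dec ¬? (α Fin.≟ γ) ×-dec ¬? (β Fin.≟ γ)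

distinct⇒injective : ∀ (e : Fin 3 → Fin 3) → Distinct (e zero) (e (suc zero)) (e (suc (suc zero))) →
                 ∀ k l → e k ≡ e l → k ≡ l
distinct⇒injective e (≢₁ , ≢₂ , ≢₃) zero             zero             eq = refl
distinct⇒injective e (≢₁ , ≢₂ , ≢₃) zero             (suc zero)       eq = contradiction eq ≢₁
distinct⇒injective e (≢₁ , ≢₂ , ≢₃) zero             (suc (suc zero)) eq = contradiction eq ≢₂
distinct⇒injective e (≢₁ , ≢₂ , ≢₃) (suc zero)       zero             eq = contradiction (sym eq) ≢₁
distinct⇒injective e (≢₁ , ≢₂ , ≢₃) (suc zero)       (suc zero)       eq = refl
distinct⇒injective e (≢₁ , ≢₂ , ≢₃) (suc zero)       (suc (suc zero)) eq = contradiction eq ≢₃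
distinct⇒injective e (≢₁ , ≢₂ , ≢₃) (suc (suc zero)) zero             eq = contradiction (sym eq) ≢₂
distinct⇒injective e (≢₁ , ≢₂ , ≢₃) (suc (suc zero)) (suc zero)       eq = contradiction (sym eq) ≢₃
distinct⇒injective e (≢₁ , ≢₂ , ≢₃) (suc (suc zero)) (suc (suc zero)) eq = refl

-- The argument in `Fin 3` is the rotation exponent modulo 3, which names the parallel class within
-- the orbit of a block with three distinct residues.
classValue : ℤ → Fin 3 → ℤ
classValue z zero    = z
classValue z (suc _) = -1ℤ

-- The three blocks of that orbit through a point have distinct exponents modulo 3, in an order that
-- depends on the point; hence the quantification over all orders. The trailing `0ℤ` matches the
-- unfolded sum in `∑₃`.
ClassSum : ℤ → Set
ClassSum z = ∀ α β γ → Distinct α β γ → classValue z α + (classValue z β + (classValue z γ + 0ℤ)) ≡ z + -[1+ 1 ]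

classSum? : ∀ z → Dec (ClassSum z)
classSum? z = Fin.all? λ α → Fin.all? λ β → Fin.all? λ γ →
  distinct? α β γ →-dec
    (classValue z α + (classValue z β + (classValue z γ + 0ℤ)) ℤ.≟ z + -[1+ 1 ])

-- The weights are chosen so that those of α with the three residues cancel, while
-- a triple of points without three distinct residues has total weight at most 0.
pairWeight : Fin 3 → Fin 3 → ℤ
pairWeight α β = if does (α Fin.≟ β) then -[1+ 1 ] else 1ℤ

pairWeight-cycle : ∀ α β →
  pairWeight α β + (pairWeight α (β ⊞ suc zero) + pairWeight α (β ⊞ suc (suc zero))) ≡ 0ℤ
pairWeight-cycle = from-yes (Fin.all? λ α → Fin.all? λ β →
  pairWeight α β + (pairWeight α (β ⊞ suc zero) + pairWeight α (β ⊞ suc (suc zero))) ℤ.≟ 0ℤ)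

-- The added 2 cancels the weight -2 of a position paired with itself, so only pairs of different
-- positions count. The transparent `sum` lets `tripleWeight≤0` be decided by evaluation.
tripleWeight : (Fin 3 → Fin 3) → ℤ
tripleWeight e = sum (λ k → sum (λ l → pairWeight (e k) (e l) + does (k Fin.≟ l) ⊙ + 2))

tripleWeight≤0 : ∀ α β γ → ¬ Distinct α β γ → tripleWeight (α ∷ᶠ β ∷ᶠ γ ∷ᶠ []ᶠ) ℤ.≤ 0ℤ
tripleWeight≤0 = from-yes (Fin.all? λ α → Fin.all? λ β → Fin.all? λ γ →
  ¬? (distinct? α β γ) →-dec (tripleWeight (α ∷ᶠ β ∷ᶠ γ ∷ᶠ []ᶠ) ℤ.≤? 0ℤ))

-- Removing full turns of 3w steps reduces a multiple of w to 0, w or 2w; the last two would make x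
-- return after w steps. Hence an orbit that does not close after w steps has full length.
∣-third : ∀ {A : Set} (f : A → A) {x w} → fold x f (3 ℕ.* w) ≡ x → fold x f w ≢ x →
          ∀ {i} → w ∣ i → fold x f i ≡ x → 3 ℕ.* w ∣ i
∣-third f {x} {w} f³ʷ fʷ (divides 0 refl) eq = (3 ℕ.* w) ∣.∣0
∣-third f {x} {w} f³ʷ fʷ (divides 1 refl) eq = contradiction (subst (λ i → fold x f i ≡ x) (ℕ.*-identityˡ w) eq) fʷ
-- As 2 * 2w = w + 3w, returning after 2w steps means returning after w.
∣-third f {x} {w} f³ʷ fʷ (divides 2 refl) eq = contradiction (begin
  fold x f w                      ≡⟨ cong (λ y → fold y f w) f³ʷ ⟨
  fold (fold x f (3 ℕ.* w)) f w   ≡⟨ fold-+ x f w ⟨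
  fold x f (w ℕ.+ 3 ℕ.* w)        ≡⟨ cong (fold x f) (ℕ.*-assoc 2 2 w) ⟩
  fold x f (2 ℕ.* (2 ℕ.* w))      ≡⟨ fold-∣ f x {2 ℕ.* w} eq (divides 2 refl) ⟩
  x                               ∎) fʷ
∣-third f {x} {w} f³ʷ fʷ (divides (suc (suc (suc q))) refl) eq = subst (3 ℕ.* w ∣_) (sym shift-three)
  (∣.∣m∣n⇒∣m+n (∣-third f f³ʷ fʷ (divides q refl) (begin
      fold x f (q ℕ.* w)                     ≡⟨ cong (λ y → fold y f (q ℕ.* w)) f³ʷ ⟨
      fold (fold x f (3 ℕ.* w)) f (q ℕ.* w)  ≡⟨ fold-+ x f (q ℕ.* w) ⟨
      fold x f (q ℕ.* w ℕ.+ 3 ℕ.* w)         ≡⟨ cong (fold x f) shift-three ⟨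
      fold x f ((3 ℕ.+ q) ℕ.* w)             ≡⟨ eq ⟩
      x                                      ∎)) ∣.∣-refl)
  where
  shift-three : (3 ℕ.+ q) ℕ.* w ≡ q ℕ.* w ℕ.+ 3 ℕ.* w
  shift-three = trans (ℕ.*-distribʳ-+ w 3 q) (ℕ.+-comm (3 ℕ.* w) (q ℕ.* w))

-- Here p, q, s will say that a block is a representative, that it is not the representative of the
-- distinguished orbit, and that its orbit is short. The hypothesis expresses that the distinguished
-- orbit is not short.
⊙-split : ∀ p q s {w v y z} → (s ≡ true → q ≡ true) →
  p ⊙ (+ (if s then w else v) * (q ⊙ (if s then y else z))) ≡
  + w * ((p ∧ s) ⊙ y) + + v * ((p ∧ q ∧ not s) ⊙ z)
⊙-split false q s {w} {v} _ = sym (cong₂ _+_ (ℤ.*-zeroʳ (+ w)) (ℤ.*-zeroʳ (+ v)))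
⊙-split true q true {w} {v} {y} s⇒q with refl ← s⇒q refl =
  sym (trans (cong (_+_ (+ w * y)) (ℤ.*-zeroʳ (+ v))) (ℤ.+-identityʳ _))
⊙-split true true false {w} {v} {z = z} _ =
  sym (trans (cong (λ t → t + + v * z) (ℤ.*-zeroʳ (+ w))) (ℤ.+-identityˡ _))
⊙-split true false false {w} {v} _ =
  sym (trans (cong (λ t → t + + v * 0ℤ) (ℤ.*-zeroʳ (+ w))) (ℤ.+-identityˡ _))

opaque
  unfolding ∑

  ∑₃ : ∀ (f : Fin 3 → ℤ) → ∑ f ≡ f zero + (f (suc zero) + (f (suc (suc zero)) + 0ℤ))
  ∑₃ f = refl

  ∑∑≡tripleWeight : ∀ (e : Fin 3 → Fin 3) →
    ∑ (λ k → ∑ (λ l → pairWeight (e k) (e l) + does (k Fin.≟ l) ⊙ + 2)) ≡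
    tripleWeight (e zero ∷ᶠ e (suc zero) ∷ᶠ e (suc (suc zero)) ∷ᶠ []ᶠ)
  ∑∑≡tripleWeight e = refl

-- The case v ≡ 9 (mod 18)

module _ {n b : ℕ} (C : CyclicTriples n b) where
  open Cyclic C

  -- The congruence enters in the form: v is odd, v = 3w, and 3 ∣ w.
  module _ {m w : ℕ} (n≡2m : n ≡ m ℕ.* 2) (v≡3w : v ≡ 3 ℕ.* w) (3∣w : 3 ∣ w) where

    instance
      w≢0 : NonZero w
      w≢0 = ℕ.≢-nonZero λ { refl → contradiction v≡3w λ () }

    w<v : w < v
    w<v = subst (w <_) (sym v≡3w) (subst (w <_) (ℕ.*-comm w 3) (ℕ.m<m*n w 3 (s≤s (s≤s z≤n))))

    3∣v : 3 ∣ v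
    3∣v = subst (3 ∣_) (sym v≡3w) (divides w (ℕ.*-comm 3 w))

    class : Fin v → Fin 3
    class x = mod₃ (toℕ x)

    class-fold : ∀ x i → class (fold x shift i) ≡ class x ⊞ mod₃ i
    class-fold x i = trans (mod₃-cong {toℕ (fold x shift i)} {toℕ x ℕ.+ i} (begin
      toℕ (fold x shift i) % 3           ≡⟨ cong (_% 3) (toℕ-fold-shift x i) ⟩
      (toℕ x ℕ.+ i) % v % 3              ≡⟨ m∣n⇒o%n%m≡o%m 3 v (toℕ x ℕ.+ i) 3∣v ⟩
      (toℕ x ℕ.+ i) % 3                  ∎)) (mod₃-+ (toℕ x) i)

    Rainbow : Fin b → Set
    Rainbow j = Distinct (class (T.point j zero)) (class (T.point j (suc zero))) (class (T.point j (suc (suc zero))))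

    -- Rotations by 1 and 2 permute the points without changing the sum, and they cycle the
    -- residues, so the three copies of the sum cancel term by term by `pairWeight-cycle`.
    ∑-pairWeight : ∀ α → ∑ (λ y → pairWeight α (class y)) ≡ 0ℤ
    ∑-pairWeight α = ℤ.*-cancelˡ-≡ (+ 3) _ 0ℤ (begin
      + 3 * ∑ h                                  ≡⟨ threefold (∑ h) ⟩
      ∑ h + (∑ h + ∑ h)                          ≡⟨ cong₂ (λ y z → ∑ h + (y + z)) (rotate 1) (rotate 2) ⟩
      ∑ h + (∑ (λ y → h (fold y shift 1)) + ∑ (λ y → h (fold y shift 2)))
                                                 ≡⟨ cong (_+_ (∑ h)) (∑-+ _ _) ⟨
      ∑ h + ∑ (λ y → h (fold y shift 1) + h (fold y shift 2))
                                                 ≡⟨ ∑-+ h _ ⟨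
      ∑ (λ y → h y + (h (fold y shift 1) + h (fold y shift 2)))
        ≡⟨ ∑-zero _ (λ y → trans
             (cong₂ (λ β γ → h y + (pairWeight α β + pairWeight α γ)) (class-fold y 1) (class-fold y 2))
             (pairWeight-cycle α (class y))) ⟩
      0ℤ                                         ∎)
      where
      h : Fin v → ℤ
      h y = pairWeight α (class y)
      threefold : ∀ z → + 3 * z ≡ z + (z + z)
      threefold = solve-∀
      rotate : ∀ i → ∑ h ≡ ∑ (λ y → h (fold y shift i))
      rotate zero    = refl
      rotate (suc i) = trans (rotate i) (trans
        (∑-reindex (λ y → h (fold y shift i)) (rotation shift n (Period.returns ∘ shift-period)))
        (∑-cong λ y → cong h (fold-comm shift y 1 i)))

    -- Otherwise every block has weight at most 0. But each row of weights sums to 0 before the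
    -- diagonal entry -2 is cancelled, hence to 2 afterwards, and the total 2v is positive.
    ∃-rainbow : ∃ Rainbow
    ∃-rainbow with Fin.any? (λ j → distinct? (class (T.point j zero)) (class (T.point j (suc zero))) (class (T.point j (suc (suc zero)))))
    ... | yes r = r
    ... | no ∄r = contradiction (subst (ℤ._≤ 0ℤ) total (∑-≤0 _ blocks≤0)) λ { (ℤ.+≤+ ()) }
      where
      ω : Fin v → Fin v → ℤ
      ω x y = pairWeight (class x) (class y) + does (x Fin.≟ y) ⊙ + 2
      ω-diag : ∀ x → ω x x ≡ 0ℤ
      ω-diag x = cong₂ (λ c d → (if c then -[1+ 1 ] else 1ℤ) + d ⊙ + 2)
        (dec-true (class x Fin.≟ class x) refl) (dec-true (x Fin.≟ x) refl)
      row : ∀ x → ∑ (ω x) ≡ + 2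
      row x = trans (∑-+ _ _) (cong₂ _+_ (∑-pairWeight (class x)) (∑-δ x λ _ → + 2))
      total : ∑ (λ j → ∑ (λ k → ∑ (λ l → ω (T.point j k) (T.point j l)))) ≡ + (v ℕ.* 2)
      total = trans (∑-pairs ω ω-diag) (trans (∑-cong row) (trans (∑-const v (+ 2)) (sym (ℤ.pos-* v 2))))
      blocks≤0 : ∀ j → ∑ (λ k → ∑ (λ l → ω (T.point j k) (T.point j l))) ℤ.≤ 0ℤ
      blocks≤0 j = subst (ℤ._≤ 0ℤ) (sym (trans
        (∑-cong λ k → ∑-cong λ l → cong (λ c → pairWeight (class (T.point j k)) (class (T.point j l)) + c ⊙ + 2)
          (does-⇔ (mk⇔ (T.point-injective j) (cong (T.point j))) (T.point j k Fin.≟ T.point j l) (k Fin.≟ l)))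
        (∑∑≡tripleWeight (class ∘ T.point j))))
        (tripleWeight≤0 _ _ _ λ d → ∄r (j , d))

    Short : Fin b → Set
    Short j = fold j σ w ≡ j

    short? : ∀ j → Dec (Short j)
    short? j = fold j σ w Fin.≟ j

    -- As 3 ∣ w, a shift by w keeps residues modulo 3. A block with one point in each residue class
    -- and fixed by this shift would have fixed points, although 0 < w < v.
    rainbow⇒¬short : ∀ {j} → Rainbow j → ¬ Short j
    rainbow⇒¬short {j} rainbow short = ℕ.<⇒≱ w<v (∣.∣⇒≤ (Period.minimal (shift-period a) w aʷ≡a))
      where
      a : Fin v
      a = T.point j zero
      hit : ∃[ k ] T.point j k ≡ fold a shift w
      hit = T.index j (subst (fold a shift w ∈ᴮ_) short (fold-∈⁺ w (T.point-∈ j zero)))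
      w≡0 : mod₃ w ≡ zero
      w≡0 = mod₃-cong {w} {0} (∣.n∣m⇒m%n≡0 w 3 3∣w)
      same-class : class (T.point j (proj₁ hit)) ≡ class a
      same-class = trans (cong class (proj₂ hit)) (trans (class-fold a w)
        (trans (cong (class a ⊞_) w≡0) (⊞-identityʳ (class a))))
      aʷ≡a : fold a shift w ≡ a
      aʷ≡a = trans (sym (proj₂ hit)) (cong (T.point j) (distinct⇒injective (class ∘ T.point j) rainbow _ _ same-class))

    short-∼ : ∀ {j k} → j ∼ k → Short j → Short k
    short-∼ {j} (i , refl) short = trans (fold-comm σ j i w) (cong (λ z → fold z σ i) short)

    size : Fin b → ℕ
    size j = if does (short? j) then w else v

    size≢0 : ∀ j → NonZero (size j)
    size≢0 j with short? j
    ... | yes _ = w≢0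
    ... | no _  = _

    w∣ : ∀ j i → fold j σ i ≡ j → w ∣ i
    w∣ j i eq = ∣.*-cancelˡ-∣ 3 (subst (_∣ 3 ℕ.* i) v≡3w (stabilizer {m} n≡2m j i eq))

    ¬short⇒v∣ : ∀ j → ¬ Short j → ∀ i → fold j σ i ≡ j → v ∣ i
    ¬short⇒v∣ j ¬short i eq = subst (_∣ i) (sym v≡3w)
      (∣-third σ (subst (λ v → fold j σ v ≡ j) v≡3w (σ^v j)) ¬short (w∣ j i eq) eq)

    period : ∀ j → Period σ (size j) j
    period j with short? j
    ... | yes short = record { returns = short ; minimal = w∣ j }
    ... | no ¬short = record { returns = σ^v j ; minimal = ¬short⇒v∣ j ¬short }

    -- Otherwise v divides the number v (v - 1) / 6 of blocks, so 3 divides v - 1.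
    ∃-short : ∃ Short
    ∃-short with Fin.any? short?
    ... | yes s = s
    ... | no ∄s = contradiction (∣.∣m+n∣m⇒∣n (subst (3 ∣_) (ℕ.+-comm 1 n) 3∣v) 3∣n) (from-no (3 ∣.∣? 1))
      where
      N : ℤ
      N = ∑ (λ r → does (rep r Fin.≟ r) ⊙ 1ℤ)
      b≡vN : + b ≡ + v * N
      b≡vN = begin
        + b                ≡⟨ ℤ.*-identityʳ (+ b) ⟨
        + b * 1ℤ           ≡⟨ ∑-const b 1ℤ ⟨
        ∑ {b} (λ _ → 1ℤ)   ≡⟨ ∑-over-orbits size size≢0 period (λ _ → 1ℤ) ⟩
        ∑ (λ r → does (rep r Fin.≟ r) ⊙ (+ size r * 1ℤ))
          ≡⟨ ∑-cong (λ r → trans (cong (λ d → does (rep r Fin.≟ r) ⊙ (+ (if d then w else v) * 1ℤ)) (dec-false (short? r) λ s → ∄s (r , s)))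
               (⊙-∧-* (does (rep r Fin.≟ r)) true (+ v) 1ℤ)) ⟩
        ∑ (λ r → + v * ((does (rep r Fin.≟ r) ∧ true) ⊙ 1ℤ))
          ≡⟨ ∑-cong (λ r → cong (λ d → + v * (d ⊙ 1ℤ)) (Bool.∧-identityʳ (does (rep r Fin.≟ r)))) ⟩
        ∑ (λ r → + v * (does (rep r Fin.≟ r) ⊙ 1ℤ))
          ≡⟨ ∑-*ˡ (+ v) _ ⟩
        + v * N ∎
      n≡6N : + n ≡ + 6 * N
      n≡6N = ℤ.*-cancelˡ-≡ (+ v) _ _ (trans (sym 6*blocks) (trans (cong (+ 6 *_) b≡vN) (swap (+ v) N)))
        where
        swap : ∀ v N → + 6 * (v * N) ≡ v * (+ 6 * N)
        swap = solve-∀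
      3∣n : 3 ∣ n
      3∣n = subst (3 ∣_) (sym (trans (cong ℤ.∣_∣ n≡6N) (ℤ.abs-* (+ 6) N)))
        (∣.∣m⇒∣m*n ℤ.∣ N ∣ (divides 2 refl))

    flow-from-rainbow : ∀ j₀ → Rainbow j₀ → NowhereZero3Flow C
    flow-from-rainbow j₀ rainbow = build (Fin.any? R₃?)
      where
      ¬short-j₀ : ¬ Short j₀
      ¬short-j₀ = rainbow⇒¬short rainbow

      -- An orbit in `R₁` has w blocks and one in `R₃` has 3w. `R₁` avoids the orbit of `j₀` by
      -- itself, since that orbit is not short.
      R₁ R₃ : Fin b → Set
      R₁ r = rep r ≡ r × Short r
      R₃ r = rep r ≡ r × r ≢ rep j₀ × ¬ Short r

      R₁? : Decidable R₁
      R₁? r = (rep r Fin.≟ r) ×-dec short? r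
      R₃? : Decidable R₃
      R₃? r = (rep r Fin.≟ r) ×-dec ¬? (r Fin.≟ rep j₀) ×-dec ¬? (short? r)

      ∃R₁ : ∃ R₁
      ∃R₁ = let j , short = ∃-short in rep j , rep-rep j , short-∼ (∼-rep j) short

      -- With K = z - 2 and v = 3w, the balance v K + 3 (w + v s) equals 3w (3s + 1 + K), whose
      -- second factor is the equation assumed here.
      from-sums : ∀ z s → Small z → ClassSum z → + 3 * s + 1ℤ + (z + -[1+ 1 ]) ≡ 0ℤ →
        (Σ[ g ∈ (Fin b → ℤ) ] (∀ r → Small (g r)) × ∑ (λ r → does (R₃? r) ⊙ g r) ≡ s) →
        (Σ[ g ∈ (Fin b → ℤ) ] (∀ r → Small (g r)) × ∑ (λ r → does (R₁? r) ⊙ g r) ≡ 1ℤ) → NowhereZero3Flow C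
      from-sums z s z-small z-sum balanced (g₃ , g₃-small , ∑g₃) (g₁ , g₁-small , ∑g₁) =
        flow-from-orbits C j₀ period-j₀ c (z + -[1+ 1 ]) c-small c-flux size size≢0 period g g-small balance
        where
        period-j₀ : Period σ v j₀
        period-j₀ = record { returns = σ^v j₀ ; minimal = ¬short⇒v∣ j₀ ¬short-j₀ }

        c : ℕ → ℤ
        c i = classValue z (mod₃ i)

        c-small : ∀ i → Small (c i)
        c-small i with mod₃ i
        ... | zero  = z-small
        ... | suc _ = from-yes (small? -1ℤ)

        -- The points of `j₀` have distinct residues, so the rotations bringing them to x have
        -- exponents distinct modulo 3: each parallel class covers x once.
        c-flux : ∀ x → ∑ (λ k → c (proj₁ (shift-transitive (T.point j₀ k) x))) ≡ z + -[1+ 1 ]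
        c-flux x = trans (∑₃ _) (z-sum _ _ _
          (apart _ _ (λ ()) , apart _ _ (λ ()) , apart _ _ (λ ())))
          where
          steps : Fin 3 → ℕ
          steps k = proj₁ (shift-transitive (T.point j₀ k) x)
          arrive : ∀ k → class (T.point j₀ k) ⊞ mod₃ (steps k) ≡ class x
          arrive k = trans (sym (class-fold (T.point j₀ k) (steps k)))
            (cong class (proj₂ (proj₂ (shift-transitive (T.point j₀ k) x))))
          apart : ∀ k l → k ≢ l → mod₃ (steps k) ≢ mod₃ (steps l)
          apart k l k≢l eq = k≢l (distinct⇒injective (class ∘ T.point j₀) rainbow k l
            (⊞-cancelʳ (mod₃ (steps k)) _ _ (trans (arrive k)
              (trans (sym (arrive l)) (cong (class (T.point j₀ l) ⊞_) (sym eq))))))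

        g : Fin b → ℤ
        g r = if does (short? r) then g₁ r else g₃ r

        g-small : ∀ r → Small (g r)
        g-small r with short? r
        ... | yes _ = g₁-small r
        ... | no _  = g₃-small r

        split : ∀ r → does (rep r Fin.≟ r) ⊙ (+ size r * (does (¬? (r Fin.≟ rep j₀)) ⊙ g r)) ≡
                      + w * (does (R₁? r) ⊙ g₁ r) + + v * (does (R₃? r) ⊙ g₃ r)
        split r = ⊙-split (does (rep r Fin.≟ r)) (does (¬? (r Fin.≟ rep j₀))) (does (short? r))
          λ isShort → dec-true (¬? (r Fin.≟ rep j₀)) λ r≡rep →
            ¬short-j₀ (short-∼ (subst (_∼ j₀) (sym r≡rep) (∼-sym (∼-rep j₀))) (does-true (short? r) isShort))

        balance : + v * (z + -[1+ 1 ]) +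
          + 3 * ∑ (λ r → does (rep r Fin.≟ r) ⊙ (+ size r * (does (¬? (r Fin.≟ rep j₀)) ⊙ g r))) ≡ 0ℤ
        balance = begin
          + v * (z + -[1+ 1 ]) + + 3 * ∑ (λ r → does (rep r Fin.≟ r) ⊙ (+ size r * (does (¬? (r Fin.≟ rep j₀)) ⊙ g r)))
            ≡⟨ cong (λ t → + v * (z + -[1+ 1 ]) + + 3 * t) (begin
                 _ ≡⟨ ∑-cong split ⟩
                 _ ≡⟨ ∑-+ _ _ ⟩
                 _ ≡⟨ cong₂ _+_ (trans (∑-*ˡ (+ w) _) (cong (+ w *_) ∑g₁)) (trans (∑-*ˡ (+ v) _) (cong (+ v *_) ∑g₃)) ⟩
                 + w * 1ℤ + + v * s ∎) ⟩
          + v * (z + -[1+ 1 ]) + + 3 * (+ w * 1ℤ + + v * s)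
            ≡⟨ cong (λ v → v * (z + -[1+ 1 ]) + + 3 * (+ w * 1ℤ + v * s)) (trans (cong +_ v≡3w) (ℤ.pos-* 3 w)) ⟩
          + 3 * + w * (z + -[1+ 1 ]) + + 3 * (+ w * 1ℤ + + 3 * + w * s)
            ≡⟨ collect (+ w) (z + -[1+ 1 ]) s ⟩
          + 3 * + w * (+ 3 * s + 1ℤ + (z + -[1+ 1 ]))
            ≡⟨ cong (+ 3 * + w *_) balanced ⟩
          + 3 * + w * 0ℤ
            ≡⟨ ℤ.*-zeroʳ (+ 3 * + w) ⟩
          0ℤ ∎
          where
          collect : ∀ w K s → + 3 * w * K + + 3 * (w * 1ℤ + + 3 * w * s) ≡ + 3 * w * (+ 3 * s + 1ℤ + K)
          collect = solve-∀

      build : Dec (∃ R₃) → NowhereZero3Flow C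
      build (yes ∃R₃) = from-sums -[1+ 1 ] 1ℤ (from-yes (small? -[1+ 1 ])) (from-yes (classSum? -[1+ 1 ])) refl
        (small-sum R₃? 1ℤ ∃R₃ small-1) (small-sum R₁? 1ℤ ∃R₁ small-1)
      -- Over the empty `R₃` every sum is 0, which forces s = 0 and hence z = 1; the default 1 for
      -- `g₃` is never counted.
      build (no ∄R₃)  = from-sums 1ℤ 0ℤ small-1 (from-yes (classSum? 1ℤ)) refl
        ((λ _ → 1ℤ) , (λ _ → small-1) , ∑-zero _ λ r → ⊙-no (R₃? r) 1ℤ λ Rr → ∄R₃ (r , Rr)) (small-sum R₁? 1ℤ ∃R₁ small-1)

    flow-9mod18 : NowhereZero3Flow C
    flow-9mod18 = let j₀ , rainbow = ∃-rainbow in flow-from-rainbow j₀ rainbow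

-- Both congruences, and the return to the given design

cyclic-flow : ∀ {n b} (C : CyclicTriples n b) → suc n ≢ 7 →
  (suc n % 6 ≡ 1) ⊎ (suc n % 18 ≡ 9) → NowhereZero3Flow C
-- `flow-1mod6` starts from a block; without blocks, as for v = 1, the flow is the empty function.
cyclic-flow {b = zero} C _ _ = (λ ()) , (λ ()) , λ x → ∑-zero _ λ ()
cyclic-flow {n} {suc _} C v≢7 (inj₁ v%6≡1) = flow-1mod6 C {suc n / 6}
  (ℕ.suc-injective (trans (m≡m%n+[m/n]*n (suc n) 6) (cong (ℕ._+ suc n / 6 ℕ.* 6) v%6≡1))) v≢7 zero
-- For v = 18s + 9 the parameters are m = 9s + 4 and w = 6s + 3 = 3 (2s + 1).
cyclic-flow {n} {suc _} C v≢7 (inj₂ v%18≡9) = flow-9mod18 C {4 ℕ.+ s ℕ.* 9} {3 ℕ.+ s ℕ.* 6}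
  (ℕ.suc-injective (trans v≡ (cong suc (even s)))) (trans v≡ (third s)) (divides (1 ℕ.+ s ℕ.* 2) (ninth s))
  where
  s : ℕ
  s = suc n / 18
  v≡ : suc n ≡ 9 ℕ.+ s ℕ.* 18
  v≡ = trans (m≡m%n+[m/n]*n (suc n) 18) (cong (ℕ._+ s ℕ.* 18) v%18≡9)
  even : ∀ s → 8 ℕ.+ s ℕ.* 18 ≡ (4 ℕ.+ s ℕ.* 9) ℕ.* 2
  even = ℕSolver.solve-∀
  third : ∀ s → 9 ℕ.+ s ℕ.* 18 ≡ 3 ℕ.* (3 ℕ.+ s ℕ.* 6)
  third = ℕSolver.solve-∀
  ninth : ∀ s → 3 ℕ.+ s ℕ.* 6 ≡ (1 ℕ.+ s ℕ.* 2) ℕ.* 3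
  ninth = ℕSolver.solve-∀

mainTheorem5 : (v : ℕ) → v ≢ 7 → (v % 6 ≡ 1) ⊎ (v % 18 ≡ 9) →
    (D : Design v) → IsSteinerTripleSystem D → IsCyclic D → ZeroSumFlow 3 D
mainTheorem5 zero _ (inj₁ ())
mainTheorem5 zero _ (inj₂ ())
mainTheorem5 (suc n) v≢7 residue D S cyc = record
  { f        = f
  ; range    = proj₁ (proj₂ flow)
  ; zero-sum = λ x → begin
      sum (λ j → does (x ∈? block j) ⊙ f j)
        ≡⟨ sum-cong-≗ (λ j → cong (_⊙ f j) (proj₂ (cyclicTriples D S cyc) x j)) ⟩
      sum (λ j → does ((proj₁ cyc ⟨$⟩ʳ x) ∈ᴮ? j) ⊙ f j)
        ≡⟨ ∑≡sum _ ⟨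
      flux f (proj₁ cyc ⟨$⟩ʳ x)
        ≡⟨ proj₂ (proj₂ flow) (proj₁ cyc ⟨$⟩ʳ x) ⟩
      0ℤ ∎
  }
  where
  open Design D
  C : CyclicTriples n #blocks
  C = proj₁ (cyclicTriples D S cyc)
  open Cyclic C
  flow : NowhereZero3Flow C
  flow = cyclic-flow C v≢7 residue
  f : Fin #blocks → ℤ
  f = proj₁ flow
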